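{- Let $\mathcal{A}_G$ be the graphic arrangement in $\mathbb{K}^\ell$ defined by a simple graph $G$ with vertex set $[\ell]=\{1,\dots,\ell\}$. Then the set $$\{\gamma_F\mid F\neq\varnothing\text{ is a clique of }G\}$$ generates $\Omega^1(\mathcal{A}_G)$ as an $S$-module, where for a non-empty subset $F\subset[\ell]$, $$\gamma_F=\sum_{u\in F}\frac{dx_u}{\prod_{v\in F,\,v\ne u}(x_v-x_u)}.$$
   Context: Let $\mathbb{K}$ be a field, $V=\mathbb{K}^\ell$ and $S=\mathbb{K}[x_1,\dots,x_\ell]$, where $x_1,\dots,x_\ell$ are the coordinate functions. For a simple graph $G$ with vertex set $[\ell]$ and edge set $E(G)$, the graphic arrangement is $\mathcal{A}_G=\{\{x_u=x_v\}\mid\{u,v\}\in E(G)\}$. A subset $F\subset[\ell]$ is a clique of $G$ if $\{u,v\}\in E(G)$ for all distinct $u,v\in F$ (so every singleton is a clique); for $F=\{p\}$ one has $\gamma_{\{p\}}=dx_p$. For a finite set $\mathcal{A}$ of linear hyperplanes in $V$, $\alpha_H\in V^*$ denotes a defining linear form of $H\in\mathcal{A}$ and $Q(\mathcal{A})=\prod_{H\in\mathcal{A}}\alpha_H$. Let $\Omega_V^1=\bigoplus_i S\,dx_i$ be the free $S$-module on $dx_1,\dots,dx_\ell$, $\Omega_V^2=\bigwedge^2\Omega_V^1$, and for $\alpha=\sum c_ix_i$ let $d\alpha=\sum c_i\,dx_i$. The module of logarithmic differential $1$-forms is $$\Omega^1(\mathcal{A})=\{\omega\in \tfrac{1}{Q(\mathcal{A})}\Omega^1_V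 \mid Q(\mathcal{A})\,\omega\wedge d\alpha_H\in\alpha_H\Omega_V^2\ \text{for all } H\in\mathcal{A}\}.$$ -}

module Defs where

open import Algebra.Bundles using (CommutativeRing)
open import Algebra.Apartness.Bundles using (HeytingField; HeytingCommutativeRing)
open import Algebra.Definitions using (Invertible)
open import Algebra.Module.Bundles using (Module)
open import Algebra.Module.Structures.Biased using (IsModuleFromLeft)
import Algebra.Construct.Pointwise as Pointwise
import Algebra.Properties.Monoid.Sum as MonoidSum
import Algebra.Properties.Ring as RingProperties
open import Data.Bool.Base using (if_then_else_)
open import Data.Empty using (⊥-elim)
open import Data.Fin.Base using (Fin; zero; suc; _<_)
open import Data.Fin.Properties using (_≟_; _<?_; <⇒≢; <-asym)
open import Data.Fin.Subset using (Subset; _∈_)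
open import Data.Fin.Subset.Properties using (_∈?_)
open import Data.List.Base using (List; []; _∷_; map; foldr; filter; allFin; cartesianProduct)
open import Data.List.Relation.Unary.All as All using (All; []; _∷_)
open import Data.List.Relation.Unary.All.Properties as All using (all-filter)
open import Data.List.Relation.Unary.AllPairs using (AllPairs; []; _∷_)
import Data.List.Relation.Unary.Unique.Propositional.Properties as Unique
open import Data.List.Relation.Unary.Unique.Propositional using (Unique)
open import Data.Nat.Base using (ℕ; zero; suc)
open import Data.Product.Base using (Σ; ∃-syntax; _×_; _,_; proj₁; proj₂)
open import Data.Vec.Functional using (Vector)
open import Function.Base using (_∘_)
open import Level using (_⊔_; 0ℓ)
open import Relation.Binary.Core using (Rel)
open import Relation.Binary.Definitions using (Decidable; Symmetric; Irreflexive)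
open import Relation.Binary.PropositionalEquality.Core as ≡ using (_≡_; _≢_)
import Relation.Binary.Reasoning.Setoid as SetoidReasoning
open import Relation.Nullary.Decidable using (does; yes; no; ¬?; _×-dec_)
open import Relation.Nullary.Negation using (¬_)
open import Relation.Unary using (Pred; _≐_)

module _ {r ℓr m ℓm} {R : CommutativeRing r ℓr} (M : Module R m ℓm) where
  private
    module R = CommutativeRing R
    module M = Module M
  open MonoidSum M.+ᴹ-monoid using (sum)

  Span : ∀ {p} → Pred M.Carrierᴹ p → Pred M.Carrierᴹ (r ⊔ m ⊔ ℓm ⊔ p)
  Span X y = ∃[ n ] Σ (Vector R.Carrier n) λ a → Σ (Vector M.Carrierᴹ n) λ x →
    (∀ i → X (x i)) × y M.≈ᴹ sum (λ i → a i M.*ₗ x i)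

  Generates : ∀ {p q} → Pred M.Carrierᴹ p → Pred M.Carrierᴹ q → Set (r ⊔ m ⊔ ℓm ⊔ p ⊔ q)
  Generates X N = Span X ≐ N

module SemiringIdentities {c ℓ} (R : CommutativeRing c ℓ) where
  open CommutativeRing R
  open import Algebra.Solver.Ring.NaturalCoefficients.Default commutativeSemiring

  interchange : ∀ w x y z →
    (w + x) + (y + z) ≈ (w + y) + (x + z)
  interchange = solve 4 (λ w x y z →
    (w :+ x) :+ (y :+ z) := (w :+ y) :+ (x :+ z)) refl

  cross : ∀ a b d e →
    (a * b) * (d * e) ≈ (a * d) * (b * e)
  cross = solve 4 (λ a b d e →
    (a :* b) :* (d :* e) := (a :* d) :* (b :* e)) refl

  frac-trans : ∀ n d′ d″ →
    d′ * (n * d″) ≈ (n * d′) * d″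
  frac-trans = solve 3 (λ n d′ d″ →
    d′ :* (n :* d″) := (n :* d′) :* d″) refl

  frac-trans′ : ∀ n d d′ →
    (n * d′) * d ≈ d′ * (n * d)
  frac-trans′ = solve 3 (λ n d d′ →
    (n :* d′) :* d := d′ :* (n :* d)) refl

  frac-+-cong : ∀ a b d d′ e e′ →
    (a * e + b * d) * (d′ * e′) ≈ (a * d′) * (e * e′) + (b * e′) * (d * d′)
  frac-+-cong = solve 6 (λ a b d d′ e e′ →
    (a :* e :+ b :* d) :* (d′ :* e′) := (a :* d′) :* (e :* e′) :+ (b :* e′) :* (d :* d′)) refl

  frac-+-assoc : ∀ a b c d e f →
    ((a * e + b * d) * f + c * (d * e)) * (d * (e * f)) ≈ (a * (e * f) + (b * f + c * e) * d) * ((d * e) * f)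
  frac-+-assoc = solve 6 (λ a b c d e f →
    ((a :* e :+ b :* d) :* f :+ c :* (d :* e)) :* (d :* (e :* f)) := (a :* (e :* f) :+ (b :* f :+ c :* e) :* d) :* ((d :* e) :* f)) refl

  frac-+-comm : ∀ a b d e →
    (a * e + b * d) * (e * d) ≈ (b * d + a * e) * (d * e)
  frac-+-comm = solve 4 (λ a b d e →
    (a :* e :+ b :* d) :* (e :* d) := (b :* d :+ a :* e) :* (d :* e)) refl

  frac-+-identityˡ : ∀ a d →
    (0# * d + a * 1#) * d ≈ a * (1# * d)
  frac-+-identityˡ = solve 2 (λ a d →
    (con 0 :* d :+ a :* con 1) :* d := a :* (con 1 :* d)) refl

  frac-*-assoc : ∀ a b c d e f →
    ((a * b) * c) * (d * (e * f)) ≈ (a * (b * c)) * ((d * e) * f)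
  frac-*-assoc = solve 6 (λ a b c d e f →
    ((a :* b) :* c) :* (d :* (e :* f)) := (a :* (b :* c)) :* ((d :* e) :* f)) refl

  frac-*-comm : ∀ a b d e →
    (a * b) * (e * d) ≈ (b * a) * (d * e)
  frac-*-comm = solve 4 (λ a b d e →
    (a :* b) :* (e :* d) := (b :* a) :* (d :* e)) refl

  frac-*-identityˡ : ∀ a d →
    (1# * a) * d ≈ a * (1# * d)
  frac-*-identityˡ = solve 2 (λ a d →
    (con 1 :* a) :* d := a :* (con 1 :* d)) refl

  frac-distribˡ : ∀ a b c d e f →
    (a * (b * f + c * e)) * ((d * e) * (d * f)) ≈ ((a * b) * (d * f) + (a * c) * (d * e)) * (d * (e * f))
  frac-distribˡ = solve 6 (λ a b c d e f →
    (a :* (b :* f :+ c :* e)) :* ((d :* e) :* (d :* f)) := ((a :* b) :* (d :* f) :+ (a :* c) :* (d :* e)) :* (d :* (e :* f))) refl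

  ι-+-homo : ∀ a b →
    (a + b) * (1# * 1#) ≈ (a * 1# + b * 1#) * 1#
  ι-+-homo = solve 2 (λ a b →
    (a :+ b) :* (con 1 :* con 1) := (a :* con 1 :+ b :* con 1) :* con 1) refl

  ι-*-homo : ∀ a b →
    (a * b) * (1# * 1#) ≈ (a * b) * 1#
  ι-*-homo = solve 2 (λ a b →
    (a :* b) :* (con 1 :* con 1) := (a :* b) :* con 1) refl

module NonZeroDivisors {c ℓ} (R : CommutativeRing c ℓ) where
  open CommutativeRing R
  open RingProperties ring
  open SetoidReasoning setoid

  Regular : Pred Carrier (c ⊔ ℓ)
  Regular a = ∀ x → a * x ≈ 0# → x ≈ 0#

  NonZeroDivisor : Set (c ⊔ ℓ)
  NonZeroDivisor = Σ Carrier Regular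

  ∏ : List Carrier → Carrier
  ∏ = foldr _*_ 1#

  regular-resp : ∀ {a b} → a ≈ b → Regular a → Regular b
  regular-resp a≈b ra x bx≈0 = ra x (trans (*-congʳ a≈b) bx≈0)

  regular-1 : Regular 1#
  regular-1 x 1x≈0 = trans (sym (*-identityˡ x)) 1x≈0

  regular-* : ∀ {a b} → Regular a → Regular b → Regular (a * b)
  regular-* {a} {b} ra rb x abx≈0 =
    rb x (ra (b * x) (trans (sym (*-assoc a b x)) abx≈0))

  regular-neg : ∀ {a} → Regular a → Regular (- a)
  regular-neg {a} ra x -ax≈0 = ra x (begin
    a * x          ≈⟨ -‿involutive (a * x) ⟨
    - (- (a * x))  ≈⟨ -‿cong (-‿distribˡ-* a x) ⟩
    - (- a * x)    ≈⟨ -‿cong -ax≈0 ⟩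
    - 0#           ≈⟨ -0#≈0# ⟩
    0#             ∎)

  regular-∏ : ∀ {as} → All Regular as → Regular (∏ as)
  regular-∏ []         = regular-1
  regular-∏ (ra ∷ ras) = regular-* ra (regular-∏ ras)

  regular-invertible : ∀ {a} → Invertible _≈_ 1# _*_ a → Regular a
  regular-invertible {a} (b , ba≈1 , _) x ax≈0 = begin
    x            ≈⟨ *-identityˡ x ⟨
    1# * x       ≈⟨ *-congʳ ba≈1 ⟨
    (b * a) * x  ≈⟨ *-assoc b a x ⟩
    b * (a * x)  ≈⟨ *-congˡ ax≈0 ⟩
    b * 0#       ≈⟨ zeroʳ b ⟩
    0#           ∎

  cancel : ∀ {a} → Regular a → ∀ {x y} → a * x ≈ a * y → x ≈ y
  cancel {a} ra {x} {y} ax≈ay = x-y≈0⇒x≈y (ra (x - y) (begin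
    a * (x - y)        ≈⟨ distribˡ a x (- y) ⟩
    a * x + a * - y    ≈⟨ +-cong ax≈ay (sym (-‿distribʳ-* a y)) ⟩
    a * y - a * y      ≈⟨ -‿inverseʳ (a * y) ⟩
    0#                 ∎))
    where
    x-y≈0⇒x≈y : x - y ≈ 0# → x ≈ y
    x-y≈0⇒x≈y p = begin
      x              ≈⟨ +-identityʳ x ⟨
      x + 0#         ≈⟨ +-congˡ (-‿inverseˡ y) ⟨
      x + (- y + y)  ≈⟨ +-assoc x (- y) y ⟨
      (x - y) + y    ≈⟨ +-congʳ p ⟩
      0# + y         ≈⟨ +-identityˡ y ⟩
      y              ∎

-- The total ring of fractions: denominators are non-zero-divisors.  Over an
-- integral domain, such as a polynomial ring over a field, this is the field
-- of fractions.

module Fractions {c ℓ} (R : CommutativeRing c ℓ) where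
  open CommutativeRing R
  open RingProperties ring
  open NonZeroDivisors R
  open SemiringIdentities R
  open SetoidReasoning setoid

  infix 8 _/_
  record Fraction : Set (c ⊔ ℓ) where
    constructor _/_
    field
      num : Carrier
      nzd : NonZeroDivisor

    den : Carrier
    den = proj₁ nzd

  open Fraction

  infix 4 _≈ᶠ_
  record _≈ᶠ_ (p q : Fraction) : Set ℓ where
    constructor mk≈ᶠ
    field
      cross-eq : num p * den q ≈ num q * den p

  open _≈ᶠ_

  infixl 6 _+ᶠ_
  infixl 7 _*ᶠ_
  infix  8 -ᶠ_
  _+ᶠ_ _*ᶠ_ : Fraction → Fraction → Fraction
  (a / (d , rd)) +ᶠ (b / (e , re)) = (a * e + b * d) / (d * e , regular-* rd re)
  (a / (d , rd)) *ᶠ (b / (e , re)) = (a * b) / (d * e , regular-* rd re)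

  -ᶠ_ : Fraction → Fraction
  -ᶠ (a / d) = (- a) / d

  ι : Carrier → Fraction
  ι a = a / (1# , regular-1)

  fractions : CommutativeRing (c ⊔ ℓ) ℓ
  fractions = record
    { Carrier = Fraction ; _≈_ = _≈ᶠ_ ; _+_ = _+ᶠ_ ; _*_ = _*ᶠ_ ; -_ = -ᶠ_
    ; 0# = ι 0# ; 1# = ι 1#
    ; isCommutativeRing = record
      { isRing = record
        { +-isAbelianGroup = record
          { isGroup = record
            { isMonoid = record
              { isSemigroup = record
                { isMagma = record
                  { isEquivalence = record
                    { refl = mk≈ᶠ refl
                    ; sym = λ p → mk≈ᶠ (sym (cross-eq p))
                    ; trans = λ {x} {y} {z} → ≈ᶠ-trans x y z }
                  ; ∙-cong = λ {x} {y} {u} {v} → +ᶠ-cong x y u v }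
                ; assoc = λ x y z → mk≈ᶠ (frac-+-assoc (num x) (num y) (num z) (den x) (den y) (den z)) }
              ; identity = +ᶠ-identityˡ , λ x → ≈ᶠ-trans _ _ _ (+ᶠ-comm x (ι 0#)) (+ᶠ-identityˡ x) }
            ; inverse = (λ x → ≈ᶠ-trans _ _ _ (+ᶠ-comm (-ᶠ x) x) (+ᶠ-inverseʳ x)) , +ᶠ-inverseʳ
            ; ⁻¹-cong = λ {x} {y} → -ᶠ-cong x y }
          ; comm = +ᶠ-comm }
        ; *-cong = λ {x} {y} {u} {v} p q → mk≈ᶠ (begin
            (num x * num u) * (den y * den v)  ≈⟨ cross _ _ _ _ ⟩
            (num x * den y) * (num u * den v)  ≈⟨ *-cong (cross-eq p) (cross-eq q) ⟩
            (num y * den x) * (num v * den u)  ≈⟨ cross _ _ _ _ ⟩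
            (num y * num v) * (den x * den u)  ∎)
        ; *-assoc = λ x y z → mk≈ᶠ (frac-*-assoc (num x) (num y) (num z) (den x) (den y) (den z))
        ; *-identity = *ᶠ-identityˡ , λ x → ≈ᶠ-trans _ _ _ (*ᶠ-comm x (ι 1#)) (*ᶠ-identityˡ x)
        ; distrib = *ᶠ-distribˡ , λ x y z → ≈ᶠ-trans _ _ _ (*ᶠ-comm (y +ᶠ z) x)
            (≈ᶠ-trans _ _ _ (*ᶠ-distribˡ x y z) (+ᶠ-cong _ _ _ _ (*ᶠ-comm x y) (*ᶠ-comm x z)))
        }
      ; *-comm = *ᶠ-comm
      }
    }
    where
    ≈ᶠ-trans : ∀ x y z → x ≈ᶠ y → y ≈ᶠ z → x ≈ᶠ z
    ≈ᶠ-trans x y z p q = mk≈ᶠ (cancel (proj₂ (nzd y)) (begin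
      den y * (num x * den z)  ≈⟨ frac-trans _ _ _ ⟩
      (num x * den y) * den z  ≈⟨ *-congʳ (cross-eq p) ⟩
      (num y * den x) * den z  ≈⟨ *-assoc _ _ _ ⟩
      num y * (den x * den z)  ≈⟨ *-congˡ (*-comm _ _) ⟩
      num y * (den z * den x)  ≈⟨ *-assoc _ _ _ ⟨
      (num y * den z) * den x  ≈⟨ *-congʳ (cross-eq q) ⟩
      (num z * den y) * den x  ≈⟨ frac-trans′ _ _ _ ⟩
      den y * (num z * den x)  ∎))

    +ᶠ-cong : ∀ x y u v → x ≈ᶠ y → u ≈ᶠ v → (x +ᶠ u) ≈ᶠ (y +ᶠ v)
    +ᶠ-cong x y u v p q = mk≈ᶠ (begin
      (num x * den u + num u * den x) * (den y * den v)
        ≈⟨ frac-+-cong _ _ _ _ _ _ ⟩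
      (num x * den y) * (den u * den v) + (num u * den v) * (den x * den y)
        ≈⟨ +-cong (*-cong (cross-eq p) (*-comm _ _)) (*-cong (cross-eq q) (*-comm _ _)) ⟩
      (num y * den x) * (den v * den u) + (num v * den u) * (den y * den x)
        ≈⟨ frac-+-cong _ _ _ _ _ _ ⟨
      (num y * den v + num v * den y) * (den x * den u) ∎)

    +ᶠ-comm : ∀ x y → (x +ᶠ y) ≈ᶠ (y +ᶠ x)
    +ᶠ-comm x y = mk≈ᶠ (frac-+-comm (num x) (num y) (den x) (den y))

    +ᶠ-identityˡ : ∀ x → (ι 0# +ᶠ x) ≈ᶠ x
    +ᶠ-identityˡ x = mk≈ᶠ (frac-+-identityˡ (num x) (den x))

    +ᶠ-inverseʳ : ∀ x → (x +ᶠ (-ᶠ x)) ≈ᶠ ι 0#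
    +ᶠ-inverseʳ x = mk≈ᶠ (begin
      (num x * den x + - num x * den x) * 1#    ≈⟨ *-identityʳ _ ⟩
      num x * den x + - num x * den x           ≈⟨ distribʳ _ _ _ ⟨
      (num x - num x) * den x                   ≈⟨ *-congʳ (-‿inverseʳ _) ⟩
      0# * den x                                ≈⟨ zeroˡ _ ⟩
      0#                                        ≈⟨ zeroˡ _ ⟨
      0# * (den x * den x)                      ∎)

    -ᶠ-cong : ∀ x y → x ≈ᶠ y → (-ᶠ x) ≈ᶠ (-ᶠ y)
    -ᶠ-cong x y p = mk≈ᶠ (begin
      - num x * den y    ≈⟨ -‿distribˡ-* _ _ ⟨
      - (num x * den y)  ≈⟨ -‿cong (cross-eq p) ⟩
      - (num y * den x)  ≈⟨ -‿distribˡ-* _ _ ⟩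
      - num y * den x    ∎)

    *ᶠ-comm : ∀ x y → (x *ᶠ y) ≈ᶠ (y *ᶠ x)
    *ᶠ-comm x y = mk≈ᶠ (frac-*-comm (num x) (num y) (den x) (den y))

    *ᶠ-identityˡ : ∀ x → (ι 1# *ᶠ x) ≈ᶠ x
    *ᶠ-identityˡ x = mk≈ᶠ (frac-*-identityˡ (num x) (den x))

    *ᶠ-distribˡ : ∀ x y z → (x *ᶠ (y +ᶠ z)) ≈ᶠ ((x *ᶠ y) +ᶠ (x *ᶠ z))
    *ᶠ-distribˡ x y z =
      mk≈ᶠ (frac-distribˡ (num x) (num y) (num z) (den x) (den y) (den z))

  -- Frac(R)ⁿ with R acting through ι
  fractionVectors : ℕ → Module R (c ⊔ ℓ) ℓ
  fractionVectors n = record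
    { Carrierᴹ = Vector Fraction n
    ; _≈ᴹ_ = λ v w → ∀ i → v i ≈ᶠ w i
    ; _+ᴹ_ = λ v w i → v i +ᶠ w i
    ; _*ₗ_ = λ a v i → ι a *ᶠ v i
    ; _*ᵣ_ = λ v a i → ι a *ᶠ v i
    ; 0ᴹ = λ _ → ι 0#
    ; -ᴹ_ = λ v i → -ᶠ v i
    ; isModule = IsModuleFromLeft.isModule {commutativeRing = R} (record
      { isLeftModule = record
        { isLeftSemimodule = record
          { +ᴹ-isCommutativeMonoid =
              Pointwise.isCommutativeMonoid (Fin n) F.+-isCommutativeMonoid
          ; isPreleftSemimodule = record
            { *ₗ-cong = λ {a} {b} {v} {w} p q i → F.*-cong {ι a} {ι b} {v i} {w i} (ι-cong p) (q i)
            ; *ₗ-zeroˡ = λ v i → F.zeroˡ (v i)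
            ; *ₗ-distribʳ = λ v a b i →
                F.trans (F.*-congʳ {v i} (ι-+ a b)) (F.distribʳ (v i) (ι a) (ι b))
            ; *ₗ-identityˡ = λ v i → F.*-identityˡ (v i)
            ; *ₗ-assoc = λ a b v i →
                F.trans (F.*-congʳ {v i} (ι-* a b)) (F.*-assoc (ι a) (ι b) (v i))
            ; *ₗ-zeroʳ = λ a i → F.zeroʳ (ι a)
            ; *ₗ-distribˡ = λ a v w i → F.distribˡ (ι a) (v i) (w i)
            }
          }
        ; -ᴹ‿cong = λ p i → F.-‿cong (p i)
        ; -ᴹ‿inverse = (λ v i → F.-‿inverseˡ (v i)) , (λ v i → F.-‿inverseʳ (v i))
        }
      })
    }
    where
    module F = CommutativeRing fractions

    ι-cong : ∀ {a b} → a ≈ b → ι a ≈ᶠ ι b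
    ι-cong p = mk≈ᶠ (*-congʳ p)

    ι-+ : ∀ a b → ι (a + b) ≈ᶠ (ι a +ᶠ ι b)
    ι-+ a b = mk≈ᶠ (ι-+-homo a b)

    ι-* : ∀ a b → ι (a * b) ≈ᶠ (ι a *ᶠ ι b)
    ι-* a b = mk≈ᶠ (ι-*-homo a b)

-- Polynomials in one variable: coefficient lists, constant term first,
-- compared coefficientwise (so trailing zeros are irrelevant).

module Univariate {c ℓ} (R : CommutativeRing c ℓ) where
  open CommutativeRing R hiding (zero)
  open SemiringIdentities R
  open SetoidReasoning setoid
  open NonZeroDivisors R
  private module ± = RingProperties ring

  Poly : Set c
  Poly = List Carrier

  coeff : Poly → ℕ → Carrier
  coeff []      _       = 0#
  coeff (a ∷ p) zero    = a
  coeff (a ∷ p) (suc i) = coeff p i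

  infix 4 _≈ᵖ_
  record _≈ᵖ_ (p q : Poly) : Set ℓ where
    constructor mk≈ᵖ
    field
      at : ∀ i → coeff p i ≈ coeff q i

  open _≈ᵖ_

  infixl 6 _+ᵖ_
  _+ᵖ_ : Poly → Poly → Poly
  []      +ᵖ q       = q
  (a ∷ p) +ᵖ []      = a ∷ p
  (a ∷ p) +ᵖ (b ∷ q) = a + b ∷ p +ᵖ q

  -ᵖ_ : Poly → Poly
  -ᵖ_ = map (-_)

  scale : Carrier → Poly → Poly
  scale a = map (a *_)

  infixl 7 _*ᵖ_
  _*ᵖ_ : Poly → Poly → Poly
  []      *ᵖ q = []
  (a ∷ p) *ᵖ q = scale a q +ᵖ (0# ∷ p *ᵖ q)

  const : Carrier → Poly
  const a = a ∷ []

  var : Poly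
  var = 0# ∷ 1# ∷ []

  coeff-+ : ∀ p q i → coeff (p +ᵖ q) i ≈ coeff p i + coeff q i
  coeff-+ []      q       i       = sym (+-identityˡ _)
  coeff-+ (a ∷ p) []      i       = sym (+-identityʳ _)
  coeff-+ (a ∷ p) (b ∷ q) zero    = refl
  coeff-+ (a ∷ p) (b ∷ q) (suc i) = coeff-+ p q i

  coeff-neg : ∀ p i → coeff (-ᵖ p) i ≈ - coeff p i
  coeff-neg []      i       = sym ±.-0#≈0#
  coeff-neg (a ∷ p) zero    = refl
  coeff-neg (a ∷ p) (suc i) = coeff-neg p i

  coeff-scale : ∀ a p i → coeff (scale a p) i ≈ a * coeff p i
  coeff-scale a []      i       = sym (zeroʳ a)
  coeff-scale a (b ∷ p) zero    = refl
  coeff-scale a (b ∷ p) (suc i) = coeff-scale a p i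

  ≈ᵖ-refl : ∀ {p} → p ≈ᵖ p
  ≈ᵖ-refl = mk≈ᵖ λ _ → refl

  ≈ᵖ-sym : ∀ {p q} → p ≈ᵖ q → q ≈ᵖ p
  ≈ᵖ-sym e = mk≈ᵖ λ i → sym (at e i)

  ≈ᵖ-trans : ∀ {p q r} → p ≈ᵖ q → q ≈ᵖ r → p ≈ᵖ r
  ≈ᵖ-trans e f = mk≈ᵖ λ i → trans (at e i) (at f i)

  ∷-cong : ∀ {a b p q} → a ≈ b → p ≈ᵖ q → (a ∷ p) ≈ᵖ (b ∷ q)
  at (∷-cong e f) zero    = e
  at (∷-cong e f) (suc i) = at f i

  0∷[] : (0# ∷ []) ≈ᵖ []
  at 0∷[] zero    = refl
  at 0∷[] (suc i) = refl

  +ᵖ-cong : ∀ {p q r s} → p ≈ᵖ q → r ≈ᵖ s → (p +ᵖ r) ≈ᵖ (q +ᵖ s)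
  +ᵖ-cong {p} {q} {r} {s} e f = mk≈ᵖ λ i → begin
    coeff (p +ᵖ r) i       ≈⟨ coeff-+ p r i ⟩
    coeff p i + coeff r i  ≈⟨ +-cong (at e i) (at f i) ⟩
    coeff q i + coeff s i  ≈⟨ coeff-+ q s i ⟨
    coeff (q +ᵖ s) i       ∎

  +ᵖ-assoc : ∀ p q r → ((p +ᵖ q) +ᵖ r) ≈ᵖ (p +ᵖ (q +ᵖ r))
  +ᵖ-assoc p q r = mk≈ᵖ λ i → begin
    coeff ((p +ᵖ q) +ᵖ r) i              ≈⟨ trans (coeff-+ (p +ᵖ q) r i) (+-congʳ (coeff-+ p q i)) ⟩
    (coeff p i + coeff q i) + coeff r i  ≈⟨ +-assoc _ _ _ ⟩
    coeff p i + (coeff q i + coeff r i)  ≈⟨ trans (coeff-+ p (q +ᵖ r) i) (+-congˡ (coeff-+ q r i)) ⟨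
    coeff (p +ᵖ (q +ᵖ r)) i              ∎

  +ᵖ-comm : ∀ p q → (p +ᵖ q) ≈ᵖ (q +ᵖ p)
  +ᵖ-comm p q = mk≈ᵖ λ i →
    trans (coeff-+ p q i) (trans (+-comm _ _) (sym (coeff-+ q p i)))

  +ᵖ-identityʳ : ∀ p → (p +ᵖ []) ≈ᵖ p
  +ᵖ-identityʳ p = +ᵖ-comm p []

  +ᵖ-inverseʳ : ∀ p → (p +ᵖ (-ᵖ p)) ≈ᵖ []
  +ᵖ-inverseʳ p = mk≈ᵖ λ i → trans (coeff-+ p (-ᵖ p) i)
    (trans (+-congˡ (coeff-neg p i)) (-‿inverseʳ _))

  -ᵖ-cong : ∀ {p q} → p ≈ᵖ q → (-ᵖ p) ≈ᵖ (-ᵖ q)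
  -ᵖ-cong {p} {q} e = mk≈ᵖ λ i →
    trans (coeff-neg p i) (trans (-‿cong (at e i)) (sym (coeff-neg q i)))

  +ᵖ-interchange : ∀ p q r s → ((p +ᵖ q) +ᵖ (r +ᵖ s)) ≈ᵖ ((p +ᵖ r) +ᵖ (q +ᵖ s))
  +ᵖ-interchange p q r s = mk≈ᵖ λ i → begin
    coeff ((p +ᵖ q) +ᵖ (r +ᵖ s)) i
      ≈⟨ trans (coeff-+ (p +ᵖ q) _ i) (+-cong (coeff-+ p q i) (coeff-+ r s i)) ⟩
    (coeff p i + coeff q i) + (coeff r i + coeff s i)
      ≈⟨ interchange _ _ _ _ ⟩
    (coeff p i + coeff r i) + (coeff q i + coeff s i)
      ≈⟨ trans (coeff-+ (p +ᵖ r) _ i) (+-cong (coeff-+ p r i) (coeff-+ q s i)) ⟨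
    coeff ((p +ᵖ r) +ᵖ (q +ᵖ s)) i ∎

  +ᵖ-swap : ∀ p q r → (p +ᵖ (q +ᵖ r)) ≈ᵖ (q +ᵖ (p +ᵖ r))
  +ᵖ-swap p q r = ≈ᵖ-trans (≈ᵖ-sym (+ᵖ-assoc p q r))
    (≈ᵖ-trans (+ᵖ-cong (+ᵖ-comm p q) ≈ᵖ-refl) (+ᵖ-assoc q p r))

  scale-cong : ∀ {a b p q} → a ≈ b → p ≈ᵖ q → scale a p ≈ᵖ scale b q
  scale-cong {a} {b} {p} {q} e f = mk≈ᵖ λ i → trans (coeff-scale a p i)
    (trans (*-cong e (at f i)) (sym (coeff-scale b q i)))

  scale-+ : ∀ a p q → scale a (p +ᵖ q) ≈ᵖ (scale a p +ᵖ scale a q)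
  scale-+ a p q = mk≈ᵖ λ i → begin
    coeff (scale a (p +ᵖ q)) i       ≈⟨ trans (coeff-scale a (p +ᵖ q) i) (*-congˡ (coeff-+ p q i)) ⟩
    a * (coeff p i + coeff q i)      ≈⟨ distribˡ _ _ _ ⟩
    a * coeff p i + a * coeff q i    ≈⟨ +-cong (coeff-scale a p i) (coeff-scale a q i) ⟨
    coeff (scale a p) i + coeff (scale a q) i ≈⟨ coeff-+ (scale a p) (scale a q) i ⟨
    coeff (scale a p +ᵖ scale a q) i ∎

  scale-0 : ∀ p → scale 0# p ≈ᵖ []
  scale-0 p = mk≈ᵖ λ i → trans (coeff-scale 0# p i) (zeroˡ _)

  scale-1 : ∀ p → scale 1# p ≈ᵖ p
  scale-1 p = mk≈ᵖ λ i → trans (coeff-scale 1# p i) (*-identityˡ _)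

  scale-scale : ∀ a b p → scale (a * b) p ≈ᵖ scale a (scale b p)
  scale-scale a b p = mk≈ᵖ λ i → begin
    coeff (scale (a * b) p) i     ≈⟨ coeff-scale (a * b) p i ⟩
    (a * b) * coeff p i           ≈⟨ *-assoc _ _ _ ⟩
    a * (b * coeff p i)           ≈⟨ *-congˡ (coeff-scale b p i) ⟨
    a * coeff (scale b p) i       ≈⟨ coeff-scale a (scale b p) i ⟨
    coeff (scale a (scale b p)) i ∎

  0∷-+ : ∀ p q → (0# ∷ p +ᵖ q) ≈ᵖ ((0# ∷ p) +ᵖ (0# ∷ q))
  0∷-+ p q = ∷-cong (sym (+-identityˡ 0#)) ≈ᵖ-refl

  *ᵖ-congˡ : ∀ p {q r} → q ≈ᵖ r → (p *ᵖ q) ≈ᵖ (p *ᵖ r)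
  *ᵖ-congˡ []      e = ≈ᵖ-refl
  *ᵖ-congˡ (a ∷ p) e = +ᵖ-cong (scale-cong refl e) (∷-cong refl (*ᵖ-congˡ p e))

  *ᵖ-zeroʳ : ∀ p → (p *ᵖ []) ≈ᵖ []
  *ᵖ-zeroʳ []      = ≈ᵖ-refl
  *ᵖ-zeroʳ (a ∷ p) = ≈ᵖ-trans (∷-cong refl (*ᵖ-zeroʳ p)) 0∷[]

  *ᵖ-∷ : ∀ p b q → (p *ᵖ (b ∷ q)) ≈ᵖ (scale b p +ᵖ (0# ∷ p *ᵖ q))
  *ᵖ-∷ []      b q = ≈ᵖ-sym 0∷[]
  *ᵖ-∷ (a ∷ p) b q = ∷-cong (+-congʳ (*-comm a b))
    (≈ᵖ-trans (+ᵖ-cong ≈ᵖ-refl (*ᵖ-∷ p b q)) (+ᵖ-swap (scale a q) (scale b p) (0# ∷ p *ᵖ q)))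

  *ᵖ-comm : ∀ p q → (p *ᵖ q) ≈ᵖ (q *ᵖ p)
  *ᵖ-comm []      q = ≈ᵖ-sym (*ᵖ-zeroʳ q)
  *ᵖ-comm (a ∷ p) q = ≈ᵖ-trans
    (+ᵖ-cong ≈ᵖ-refl (∷-cong refl (*ᵖ-comm p q))) (≈ᵖ-sym (*ᵖ-∷ q a p))

  *ᵖ-congʳ : ∀ {p q} r → p ≈ᵖ q → (p *ᵖ r) ≈ᵖ (q *ᵖ r)
  *ᵖ-congʳ {p} {q} r e =
    ≈ᵖ-trans (*ᵖ-comm p r) (≈ᵖ-trans (*ᵖ-congˡ r e) (*ᵖ-comm r q))

  *ᵖ-distribˡ : ∀ p q r → (p *ᵖ (q +ᵖ r)) ≈ᵖ ((p *ᵖ q) +ᵖ (p *ᵖ r))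
  *ᵖ-distribˡ []      q r = ≈ᵖ-refl
  *ᵖ-distribˡ (a ∷ p) q r = ≈ᵖ-trans
    (+ᵖ-cong (scale-+ a q r)
      (≈ᵖ-trans (∷-cong refl (*ᵖ-distribˡ p q r)) (0∷-+ (p *ᵖ q) (p *ᵖ r))))
    (+ᵖ-interchange (scale a q) (scale a r) (0# ∷ p *ᵖ q) (0# ∷ p *ᵖ r))

  *ᵖ-distribʳ : ∀ p q r → ((q +ᵖ r) *ᵖ p) ≈ᵖ ((q *ᵖ p) +ᵖ (r *ᵖ p))
  *ᵖ-distribʳ p q r = ≈ᵖ-trans (*ᵖ-comm (q +ᵖ r) p)
    (≈ᵖ-trans (*ᵖ-distribˡ p q r) (+ᵖ-cong (*ᵖ-comm p q) (*ᵖ-comm p r)))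

  scale-*ᵖ : ∀ a p q → (scale a p *ᵖ q) ≈ᵖ scale a (p *ᵖ q)
  scale-*ᵖ a []      q = ≈ᵖ-refl
  scale-*ᵖ a (b ∷ p) q = ≈ᵖ-trans
    (+ᵖ-cong (scale-scale a b q) (∷-cong (sym (zeroʳ a)) (scale-*ᵖ a p q)))
    (≈ᵖ-sym (scale-+ a (scale b q) (0# ∷ p *ᵖ q)))

  *ᵖ-assoc : ∀ p q r → ((p *ᵖ q) *ᵖ r) ≈ᵖ (p *ᵖ (q *ᵖ r))
  *ᵖ-assoc []      q r = ≈ᵖ-refl
  *ᵖ-assoc (a ∷ p) q r = ≈ᵖ-trans (*ᵖ-distribʳ r (scale a q) (0# ∷ p *ᵖ q))
    (+ᵖ-cong (scale-*ᵖ a q r)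
      (+ᵖ-cong (scale-0 r) (∷-cong refl (*ᵖ-assoc p q r))))

  *ᵖ-identityˡ : ∀ p → (const 1# *ᵖ p) ≈ᵖ p
  *ᵖ-identityˡ p = ≈ᵖ-trans (+ᵖ-cong (scale-1 p) 0∷[]) (+ᵖ-identityʳ p)

  polynomials : CommutativeRing c ℓ
  polynomials = record
    { Carrier = Poly ; _≈_ = _≈ᵖ_ ; _+_ = _+ᵖ_ ; _*_ = _*ᵖ_ ; -_ = -ᵖ_
    ; 0# = [] ; 1# = const 1#
    ; isCommutativeRing = record
      { isRing = record
        { +-isAbelianGroup = record
          { isGroup = record
            { isMonoid = record
              { isSemigroup = record
                { isMagma = record
                  { isEquivalence = record { refl = ≈ᵖ-refl ; sym = ≈ᵖ-sym ; trans = ≈ᵖ-trans }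
                  ; ∙-cong = +ᵖ-cong }
                ; assoc = +ᵖ-assoc }
              ; identity = (λ _ → ≈ᵖ-refl) , +ᵖ-identityʳ }
            ; inverse = (λ p → ≈ᵖ-trans (+ᵖ-comm (-ᵖ p) p) (+ᵖ-inverseʳ p)) , +ᵖ-inverseʳ
            ; ⁻¹-cong = -ᵖ-cong }
          ; comm = +ᵖ-comm }
        ; *-cong = λ {p} {q} {r} {s} e f → ≈ᵖ-trans (*ᵖ-congʳ r e) (*ᵖ-congˡ q f)
        ; *-assoc = *ᵖ-assoc
        ; *-identity = *ᵖ-identityˡ , λ p → ≈ᵖ-trans (*ᵖ-comm p (const 1#)) (*ᵖ-identityˡ p)
        ; distrib = *ᵖ-distribˡ , *ᵖ-distribʳ
        }
      ; *-comm = *ᵖ-comm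
      }
    }

  const-cong : ∀ {a b} → a ≈ b → const a ≈ᵖ const b
  const-cong p = mk≈ᵖ λ { zero → p ; (suc i) → refl }

  const-* : ∀ a b → (const a *ᵖ const b) ≈ᵖ const (a * b)
  const-* a b = mk≈ᵖ λ { zero → +-identityʳ _ ; (suc i) → refl }

  private
    module Pₘ = CommutativeRing polynomials
    module Σᵖ = MonoidSum Pₘ.+-monoid
    module Σᴿ = MonoidSum +-monoid

  sum-const : ∀ m (f g : Vector Carrier m) →
    Σᵖ.sum (λ i → const (f i) *ᵖ const (g i)) ≈ᵖ const (Σᴿ.sum (λ i → f i * g i))
  sum-const zero    f g = mk≈ᵖ λ { zero → refl ; (suc i) → refl }
  sum-const (suc m) f g =
    Pₘ.+-cong (const-* (f zero) (g zero)) (sum-const m (f ∘ suc) (g ∘ suc))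

  linear-form : ∀ a m (f g : Vector Carrier m) →
    (const a *ᵖ var +ᵖ Σᵖ.sum (λ i → const (f i) *ᵖ const (g i))) ≈ᵖ
    (Σᴿ.sum (λ i → f i * g i) ∷ a ∷ [])
  linear-form a m f g = Pₘ.trans (Pₘ.+-congˡ {const a *ᵖ var} (sum-const m f g)) (mk≈ᵖ λ
    { zero          → trans (+-congʳ (trans (+-identityʳ _) (zeroʳ _))) (+-identityˡ _)
    ; (suc zero)    → *-identityʳ _
    ; (suc (suc i)) → refl })

  open NonZeroDivisors polynomials using () renaming (Regular to Regularᵖ)

  coeff-const-*-0 : ∀ a q i → coeff (const a *ᵖ q) i ≈ a * coeff q i
  coeff-const-*-0 a q i = begin
    coeff (const a *ᵖ q) i                        ≈⟨ coeff-+ (scale a q) (0# ∷ []) i ⟩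
    coeff (scale a q) i + coeff (0# ∷ []) i       ≈⟨ +-cong (coeff-scale a q i) (at 0∷[] i) ⟩
    a * coeff q i + 0#                            ≈⟨ +-identityʳ _ ⟩
    a * coeff q i                                 ∎

  coeff-linear-zero : ∀ b a q → coeff ((b ∷ a ∷ []) *ᵖ q) 0 ≈ b * coeff q 0
  coeff-linear-zero b a q = begin
    coeff ((b ∷ a ∷ []) *ᵖ q) 0        ≈⟨ coeff-+ (scale b q) (0# ∷ const a *ᵖ q) 0 ⟩
    coeff (scale b q) 0 + 0#           ≈⟨ +-identityʳ _ ⟩
    coeff (scale b q) 0                ≈⟨ coeff-scale b q 0 ⟩
    b * coeff q 0                      ∎

  coeff-linear-suc : ∀ b a q i →
    coeff ((b ∷ a ∷ []) *ᵖ q) (suc i) ≈ b * coeff q (suc i) + a * coeff q i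
  coeff-linear-suc b a q i = begin
    coeff ((b ∷ a ∷ []) *ᵖ q) (suc i)
      ≈⟨ coeff-+ (scale b q) (0# ∷ const a *ᵖ q) (suc i) ⟩
    coeff (scale b q) (suc i) + coeff (const a *ᵖ q) i
      ≈⟨ +-cong (coeff-scale b q (suc i)) (coeff-const-*-0 a q i) ⟩
    b * coeff q (suc i) + a * coeff q i ∎

  regular-const : ∀ {a} → Regular a → Regularᵖ (const a)
  regular-const {a} ra q aq≈0 = mk≈ᵖ λ i →
    ra (coeff q i) (trans (sym (coeff-const-*-0 a q i)) (at aq≈0 i))

  regular-leading : ∀ b {a} → Regular a → Regularᵖ (b ∷ a ∷ [])
  regular-leading b {a} ra q e = mk≈ᵖ (go q λ i →
    trans (sym (coeff-linear-suc b a q i)) (at e (suc i)))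
    where
    go : ∀ q → (∀ i → b * coeff q (suc i) + a * coeff q i ≈ 0#) → ∀ i → coeff q i ≈ 0#
    go []      _ _       = refl
    go (x ∷ q) h (suc i) = go q (λ j → h (suc j)) i
    go (x ∷ q) h zero    = ra x (begin
      a * x                   ≈⟨ +-identityˡ _ ⟨
      0# + a * x              ≈⟨ +-congʳ (zeroʳ b) ⟨
      b * 0# + a * x          ≈⟨ +-congʳ (*-congˡ (go q (λ j → h (suc j)) zero)) ⟨
      b * coeff q 0 + a * x   ≈⟨ h zero ⟩
      0#                      ∎)

  regular-constant-term : ∀ {b} a → Regular b → Regularᵖ (b ∷ a ∷ [])
  regular-constant-term {b} a rb q e = mk≈ᵖ go
    where
    go : ∀ i → coeff q i ≈ 0#
    go zero    = rb _ (trans (sym (coeff-linear-zero b a q)) (at e 0))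
    go (suc i) = rb _ (begin
      b * coeff q (suc i)                  ≈⟨ +-identityʳ _ ⟨
      b * coeff q (suc i) + 0#             ≈⟨ +-congˡ (zeroʳ a) ⟨
      b * coeff q (suc i) + a * 0#         ≈⟨ +-congˡ (*-congˡ (go i)) ⟨
      b * coeff q (suc i) + a * coeff q i  ≈⟨ coeff-linear-suc b a q i ⟨
      coeff ((b ∷ a ∷ []) *ᵖ q) (suc i)    ≈⟨ at e (suc i) ⟩
      0#                                   ∎)

-- R[x₁,…,xₙ] as the iterated ring R[xₙ]⋯[x₁].

module Multivariate {c ℓ} (R : CommutativeRing c ℓ) where
  private module R = CommutativeRing R

  polynomialRing : ℕ → CommutativeRing c ℓ
  polynomialRing zero    = R
  polynomialRing (suc n) = Univariate.polynomials (polynomialRing n)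

  Polynomial : ℕ → Set c
  Polynomial n = CommutativeRing.Carrier (polynomialRing n)

  constant : ∀ n → R.Carrier → Polynomial n
  constant zero    a = a
  constant (suc n) a = Univariate.const (polynomialRing n) (constant n a)

  x[_] : ∀ {n} → Fin n → Polynomial n
  x[_] {suc n} zero    = Univariate.var (polynomialRing n)
  x[_] {suc n} (suc i) = Univariate.const (polynomialRing n) x[ i ]

  linear : ∀ {n} → Vector R.Carrier n → Polynomial n
  linear {n} α = sum (λ i → constant n (α i) * x[ i ])
    where
    open CommutativeRing (polynomialRing n) using (_*_; +-monoid)
    open MonoidSum +-monoid using (sum)

  private
    module P n = CommutativeRing (polynomialRing n)
    module NZD n = NonZeroDivisors (polynomialRing n)
    module U n = Univariate (polynomialRing n)

  constant-* : ∀ n a b → P._≈_ n (P._*_ n (constant n a) (constant n b)) (constant n (a R.* b))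
  constant-* zero    a b = R.refl
  constant-* (suc n) a b = P.trans (suc n)
    (U.const-* n (constant n a) (constant n b)) (U.const-cong n (constant-* n a b))

  constant-≈1 : ∀ n {a} → a R.≈ R.1# → P._≈_ n (constant n a) (P.1# n)
  constant-≈1 zero    p = p
  constant-≈1 (suc n) p = U.const-cong n (constant-≈1 n p)

  constant-invertible : ∀ n {a} → Invertible R._≈_ R.1# R._*_ a →
    Invertible (P._≈_ n) (P.1# n) (P._*_ n) (constant n a)
  constant-invertible n {a} (b , ba , ab) = constant n b ,
    P.trans n (constant-* n b a) (constant-≈1 n ba) ,
    P.trans n (constant-* n a b) (constant-≈1 n ab)

  linear-suc : ∀ {n} (α : Vector R.Carrier (suc n)) →
    P._≈_ (suc n) (linear (α ∘ suc) ∷ constant n (α zero) ∷ []) (linear α)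
  linear-suc {n} α = P.sym (suc n)
    (U.linear-form n (constant n (α zero)) n (λ i → constant n (α (suc i))) x[_])

  regular-linear : ∀ {n} (α : Vector R.Carrier n) i →
    Invertible R._≈_ R.1# R._*_ (α i) → NonZeroDivisors.Regular (polynomialRing n) (linear α)
  regular-linear {suc n} α zero inv = NZD.regular-resp (suc n) (linear-suc α)
    (U.regular-leading n _ (NZD.regular-invertible n (constant-invertible n inv)))
  regular-linear {suc n} α (suc i) inv = NZD.regular-resp (suc n) (linear-suc α)
    (U.regular-constant-term n _ (regular-linear (α ∘ suc) i inv))

  regular-difference : ∀ {n} {u v : Fin n} → u ≢ v →
    NonZeroDivisors.Regular (polynomialRing n) (P._-_ n x[ u ] x[ v ])
  regular-difference {suc n} {zero}  {zero}  u≢v = ⊥-elim (u≢v ≡.refl)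
  regular-difference {suc n} {zero}  {suc v} _   = U.regular-leading n _ (NZD.regular-1 n)
  regular-difference {suc n} {suc u} {zero}  _   =
    U.regular-leading n _ (NZD.regular-neg n (NZD.regular-1 n))
  regular-difference {suc n} {suc u} {suc v} u≢v =
    U.regular-const n (regular-difference (u≢v ∘ ≡.cong suc))

-- Differential forms in dx₁,…,dxₙ, in coordinates: a 1-form ω is
-- Σᵢ ω i dxᵢ, and a 2-form θ is Σ_{i<j} θ i j dxᵢ∧dxⱼ.

module Forms {c ℓ} (R : CommutativeRing c ℓ) (n : ℕ) where
  open CommutativeRing R

  Form₁ Form₂ : Set c
  Form₁ = Vector Carrier n
  Form₂ = (i j : Fin n) → .(i < j) → Carrier

  infix 4 _≈₁_ _≈₂_
  _≈₁_ : Rel Form₁ ℓ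
  ω ≈₁ η = ∀ i → ω i ≈ η i

  _≈₂_ : Rel Form₂ ℓ
  θ ≈₂ ϑ = ∀ i j .(i<j : i < j) → θ i j i<j ≈ ϑ i j i<j

  infixr 7 _•₁_ _•₂_
  _•₁_ : Carrier → Form₁ → Form₁
  (a •₁ ω) i = a * ω i

  _•₂_ : Carrier → Form₂ → Form₂
  (a •₂ θ) i j i<j = a * θ i j i<j

  infixl 6 _∧_
  _∧_ : Form₁ → Form₁ → Form₂
  (ω ∧ η) i j _ = ω i * η j - ω j * η i

  basis : Fin n → Form₁
  basis u i = if does (u ≟ i) then 1# else 0#

module _ {c ℓ} (R : CommutativeRing c ℓ) where
  open CommutativeRing R hiding (zero)
  open MonoidSum +-monoid using (sum)

  sum-zero : ∀ n (f : Vector Carrier n) → sum (λ i → f i * 0#) ≈ 0#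
  sum-zero zero    f = refl
  sum-zero (suc n) f = trans (+-cong (zeroʳ _) (sum-zero n (f ∘ suc))) (+-identityˡ 0#)

  sum-basis : ∀ n (f : Vector Carrier n) u → sum (λ i → f i * Forms.basis R n u i) ≈ f u
  sum-basis (suc n) f zero    = trans (+-cong (*-identityʳ _) (sum-zero n (f ∘ suc))) (+-identityʳ _)
  sum-basis (suc n) f (suc u) = trans (+-cong (zeroʳ _) (sum-basis n (f ∘ suc) u)) (+-identityˡ _)

record SimpleGraph (n : ℕ) : Set₁ where
  infix 4 _~_ _~?_
  field
    _~_      : Rel (Fin n) 0ℓ
    _~?_     : Decidable _~_
    ~-sym    : Symmetric _~_
    ~-irrefl : Irreflexive _≡_ _~_

  IsEdge : Pred (Fin n × Fin n) 0ℓ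
  IsEdge (u , v) = u < v × u ~ v

  -- each edge {u,v} once, as the pair (u , v) with u < v
  edges : List (Fin n × Fin n)
  edges = filter (λ (u , v) → (u <? v) ×-dec (u ~? v)) (cartesianProduct (allFin n) (allFin n))

  edges-unique : Unique edges
  edges-unique = Unique.filter⁺ _ (Unique.cartesianProduct⁺ (Unique.allFin⁺ n) (Unique.allFin⁺ n))

  edges-sound : All IsEdge edges
  edges-sound = all-filter _ (cartesianProduct (allFin n) (allFin n))

  IsClique : Pred (Subset n) 0ℓ
  IsClique F = ∀ {u v} → u ∈ F → v ∈ F → u ≢ v → u ~ v

module Arrangements {c ℓ₁ ℓ₂} (𝕂 : HeytingField c ℓ₁ ℓ₂) (n : ℕ) where
  open HeytingField 𝕂 using (_#_; #-irrefl; #⇒invertible; invertible⇒#; heytingCommutativeRing)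

  scalars : CommutativeRing c ℓ₁
  scalars = HeytingCommutativeRing.commutativeRing heytingCommutativeRing

  private module K = CommutativeRing scalars

  open Multivariate scalars public using (constant; x[_]; linear)
  open Multivariate scalars using (polynomialRing; regular-linear; regular-difference)

  S : CommutativeRing c ℓ₁
  S = polynomialRing n

  module S = CommutativeRing S

  open NonZeroDivisors S using (NonZeroDivisor; ∏; regular-∏; Regular)
  open Fractions S using (fractions; fractionVectors; ι; _/_)

  -- ΩV: polynomial forms (Ω¹_V and Ω²_V); ΩF: forms with coefficients in Frac(S)
  module ΩV = Forms S n
  module ΩF = Forms fractions n

  -- The S-module whose elements are the forms in ΩF.Form₁
  RationalForms : Module S (c ⊔ ℓ₁) ℓ₁
  RationalForms = fractionVectors n

  ι₂ : ΩV.Form₂ → ΩF.Form₂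
  ι₂ θ i j i<j = ι (θ i j i<j)

  infix 8 _÷_
  _÷_ : ΩV.Form₁ → NonZeroDivisor → ΩF.Form₁
  (η ÷ q) i = η i / q

  -- A hyperplane of V = 𝕂ⁿ comes with a choice of defining form α_H, given by
  -- its coefficients.  In a Heyting field "c # 0" says that c is invertible.
  record Hyperplane : Set (c ⊔ ℓ₁ ⊔ ℓ₂) where
    field
      form    : Vector K.Carrier n
      nonzero : ∃[ i ] form i # K.0#

  open Hyperplane public

  Points : Hyperplane → Pred (Vector K.Carrier n) ℓ₁
  Points H x = MonoidSum.sum K.+-monoid (λ i → form H i K.* x i) K.≈ K.0#

  -- A finite set of hyperplanes: a list without two equal zero sets
  record Arrangement : Set (c ⊔ ℓ₁ ⊔ ℓ₂) where
    field
      hyperplanes : List Hyperplane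
      distinct    : AllPairs (λ H H′ → ¬ Points H ≐ Points H′) hyperplanes

  open Arrangement public

  α[_] : Hyperplane → S.Carrier
  α[ H ] = linear (form H)

  dα[_] : Hyperplane → ΩV.Form₁
  dα[ H ] i = constant n (form H i)

  regular-α : ∀ H → Regular α[ H ]
  regular-α H = let i , αᵢ#0 = nonzero H in
    regular-linear (form H) i (invertible αᵢ#0)
    where
    invertible : ∀ {a} → a # K.0# → Invertible K._≈_ K.1# K._*_ a
    invertible {a} a#0 = let b , ba , ab = #⇒invertible a#0 in
      b , K.trans (K.*-congˡ (K.sym a-0)) ba , K.trans (K.*-congʳ (K.sym a-0)) ab
      where
      a-0 : a K.- K.0# K.≈ a
      a-0 = K.trans (K.+-congˡ (RingProperties.-0#≈0# K.ring)) (K.+-identityʳ a)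

  Q : Arrangement → NonZeroDivisor
  Q 𝒜 = ∏ (map α[_] (hyperplanes 𝒜)) ,
        regular-∏ (All.map⁺ (All.universal regular-α (hyperplanes 𝒜)))

  Ω¹ : Arrangement → Pred ΩF.Form₁ (c ⊔ ℓ₁ ⊔ ℓ₂)
  Ω¹ 𝒜 ω =
    (∃[ η ] ω ΩF.≈₁ η ÷ Q 𝒜) ×
    All (λ H → ∃[ θ ] (ι (proj₁ (Q 𝒜)) ΩF.•₁ ω) ΩF.∧ (ι ∘ dα[ H ]) ΩF.≈₂ ι₂ (α[ H ] ΩV.•₂ θ))
        (hyperplanes 𝒜)

  module _ (F : Subset n) where
    others : Fin n → List (Fin n)
    others u = filter (λ v → (v ∈? F) ×-dec ¬? (v ≟ u)) (allFin n)

    γ-denominator : Fin n → NonZeroDivisor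
    γ-denominator u =
      ∏ (map (λ v → x[ v ] S.- x[ u ]) (others u)) ,
      regular-∏ (All.map⁺ (All.map (λ (_ , v≢u) → regular-difference v≢u)
        (all-filter (λ v → (v ∈? F) ×-dec ¬? (v ≟ u)) (allFin n))))

    γ : ΩF.Form₁
    γ = foldr _+ᴹ_ 0ᴹ
      (map (λ u → ΩV.basis u ÷ γ-denominator u) (filter (_∈? F) (allFin n)))
      where open Module RationalForms using (_+ᴹ_; 0ᴹ)

  private
    module FK = Forms scalars n

  x-0≈x : ∀ x → x K.- K.0# K.≈ x
  x-0≈x x = K.trans (K.+-congˡ (RingProperties.-0#≈0# K.ring)) (K.+-identityʳ x)

  1≉0 : ¬ K.1# K.≈ K.0#
  1≉0 1≈0 = #-irrefl 1≈0 (invertible⇒# (K.1# ,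
    K.trans (K.*-identityˡ _) (x-0≈x _) , K.trans (K.*-identityʳ _) (x-0≈x _)))

  basis-diagonal : ∀ u → FK.basis u u ≡ K.1#
  basis-diagonal u with u ≟ u
  ... | yes _  = ≡.refl
  ... | no u≢u = ⊥-elim (u≢u ≡.refl)

  basis-off : ∀ {u i} → u ≢ i → FK.basis u i ≡ K.0#
  basis-off {u} {i} u≢i with u ≟ i
  ... | yes u≡i = ⊥-elim (u≢i u≡i)
  ... | no _    = ≡.refl

  -- {x_u = x_v}: the standard basis here gives coefficients of the form x_u − x_v
  diagonal : ∀ {u v} → u ≢ v → Hyperplane
  diagonal {u} {v} u≢v = record
    { form    = λ i → FK.basis u i K.- FK.basis v i
    ; nonzero = u , invertible⇒# (K.1# ,
        K.trans (K.*-identityˡ _) one , K.trans (K.*-identityʳ _) one)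
    }
    where
    one : (FK.basis u u K.- FK.basis v u) K.- K.0# K.≈ K.1#
    one rewrite basis-diagonal u | basis-off (u≢v ∘ ≡.sym) =
      K.trans (x-0≈x _) (x-0≈x _)

  module _ {u v : Fin n} (u≢v : u ≢ v) where
    basis∈ : ∀ {w} → u ≢ w → v ≢ w → Points (diagonal u≢v) (FK.basis w)
    basis∈ {w} u≢w v≢w = K.trans (sum-basis scalars n _ w) zero-at
      where
      zero-at : FK.basis u w K.- FK.basis v w K.≈ K.0#
      zero-at rewrite basis-off u≢w | basis-off v≢w = x-0≈x _

    basis-u∉ : ¬ Points (diagonal u≢v) (FK.basis u)
    basis-u∉ p = 1≉0 (K.trans (K.sym one) (K.trans (K.sym (sum-basis scalars n _ u)) p))
      where
      one : FK.basis u u K.- FK.basis v u K.≈ K.1#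
      one rewrite basis-diagonal u | basis-off (u≢v ∘ ≡.sym) = x-0≈x _

    basis-v∉ : ¬ Points (diagonal u≢v) (FK.basis v)
    basis-v∉ p = 1≉0 (begin
      K.1#                            ≈⟨ -‿involutive K.1# ⟨
      K.- (K.- K.1#)                  ≈⟨ K.-‿cong minus-one ⟨
      K.- (FK.basis u v K.- FK.basis v v)
                                      ≈⟨ K.-‿cong (K.trans (K.sym (sum-basis scalars n _ v)) p) ⟩
      K.- K.0#                        ≈⟨ -0#≈0# ⟩
      K.0#                            ∎)
      where
      open RingProperties K.ring using (-‿involutive; -0#≈0#)
      open SetoidReasoning K.setoid
      minus-one : FK.basis u v K.- FK.basis v v K.≈ K.- K.1#
      minus-one rewrite basis-off u≢v | basis-diagonal v = K.+-identityˡ _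

  diagonals-distinct : ∀ {u v u′ v′} (u<v : u < v) (u′<v′ : u′ < v′) → (u , v) ≢ (u′ , v′) →
    ¬ Points (diagonal (<⇒≢ u<v)) ≐ Points (diagonal (<⇒≢ u′<v′))
  diagonals-distinct {u} {v} {u′} {v′} u<v u′<v′ e≢e′ (_ , H′⊆H)
    with u′ ≟ u | v′ ≟ u
  ... | no u′≢u | no v′≢u = basis-u∉ (<⇒≢ u<v) (H′⊆H (basis∈ (<⇒≢ u′<v′) u′≢u v′≢u))
  ... | yes u′≡u | _ with u′ ≟ v | v′ ≟ v
  ...   | no u′≢v | no v′≢v = basis-v∉ (<⇒≢ u<v) (H′⊆H (basis∈ (<⇒≢ u′<v′) u′≢v v′≢v))
  ...   | yes u′≡v | _ = <⇒≢ u<v (≡.trans (≡.sym u′≡u) u′≡v)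
  ...   | no _ | yes v′≡v = e≢e′ (≡.sym (≡.cong₂ _,_ u′≡u v′≡v))
  diagonals-distinct {u} {v} {u′} {v′} u<v u′<v′ e≢e′ (_ , H′⊆H)
    | no _ | yes v′≡u with u′ ≟ v | v′ ≟ v
  ...   | no u′≢v | no v′≢v = basis-v∉ (<⇒≢ u<v) (H′⊆H (basis∈ (<⇒≢ u′<v′) u′≢v v′≢v))
  ...   | yes ≡.refl | _ = <-asym u<v (≡.subst (u′ <_) v′≡u u′<v′)
  ...   | no _ | yes v′≡v = <⇒≢ u<v (≡.trans (≡.sym v′≡u) v′≡v)

  module _ (G : SimpleGraph n) where
    open SimpleGraph G

    edgeHyperplane : ∀ {e} → IsEdge e → Hyperplane
    edgeHyperplane (u<v , _) = diagonal (<⇒≢ u<v)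

    edgeHyperplanes-distinct : ∀ {es} (ps : All IsEdge es) → Unique es →
      AllPairs (λ H H′ → ¬ Points H ≐ Points H′) (All.reduce edgeHyperplane ps)
    edgeHyperplanes-distinct []       []         = []
    edgeHyperplanes-distinct (p ∷ ps) (e≢ ∷ unq) =
      from-first p ps e≢ ∷ edgeHyperplanes-distinct ps unq
      where
      from-first : ∀ {e es} (p : IsEdge e) (ps : All IsEdge es) → All (e ≢_) es →
        All (λ H′ → ¬ Points (edgeHyperplane p) ≐ Points H′) (All.reduce edgeHyperplane ps)
      from-first p []       []         = []
      from-first p (q ∷ qs) (e≢ ∷ es≢) =
        diagonals-distinct (proj₁ p) (proj₁ q) e≢ ∷ from-first p qs es≢

    graphicArrangement : Arrangement
    graphicArrangement = record
      { hyperplanes = All.reduce edgeHyperplane edges-sound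
      ; distinct    = edgeHyperplanes-distinct edges-sound edges-unique
      }

{-# OPTIONS --safe #-}

-- Write ω = Σ h_u dx_u / Δ_u with Δ_u = ∏_{j ≠ u} (x_j − x_u).  Then ω is logarithmic along A_G
-- iff h is a polynomial vector with h_u ≡ h_v mod (x_u − x_v) for every edge uv and h_u ≡ 0
-- mod (x_u − x_v) for every non-edge uv, and γ_F corresponds to e_F(u) = ∏_{j ∉ F} (x_j − x_u).
-- To express such an h by clique vectors, fix a vertex p and put y_v = x_v − x_p.  The coordinate
-- h_p lies in (y_v , y_j) for all non-adjacent v ≠ j, where y_p = 0.  If f lies in these ideals
-- for v , j in a vertex set T ∋ p, then f · e_T(p) is attained at p by the span of the e_F with F
-- a clique through p: for a non-adjacent pair v , j, the substitution x_v ↦ x_p splits f into a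
-- multiple of y_j and a multiple of y_v, and the factors y_j and y_v are absorbed by e_{T−j}(p)
-- and e_{T−v}(p).  Starting from T = [ℓ], f = h_p, this makes the coordinate h_p vanish; one then
-- deletes all edges at p and continues with the next vertex.
module Submission where

open import Algebra.Apartness.Bundles using (HeytingField)
open import Algebra.Bundles using (CommutativeRing)
open import Algebra.Module.Bundles using (Module)
open import Algebra.Morphism.Structures using (IsRingHomomorphism)
import Algebra.Morphism.Construct.Composition as Composition
import Algebra.Morphism.Construct.Identity as Identity
import Algebra.Properties.CommutativeMonoid.Sum as CommutativeMonoidSum
import Algebra.Properties.Group as GroupProperties
import Algebra.Properties.Monoid.Sum as MonoidSum
import Algebra.Properties.Ring as RingProperties
open import Data.Bool.Base using (true; false; if_then_else_)
open import Data.Empty using (⊥-elim)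
open import Data.Fin.Base using (Fin; zero; suc; _<_)
open import Data.Fin.Properties using (_≟_; _<?_; any?; <⇒≢; <-asym; <-cmp)
open import Data.Fin.Subset using (Subset; _∈_; _∉_; ⊤; ∣_∣; Nonempty; inside; outside)
  renaming (_-_ to _∖_)
open import Data.Fin.Subset.Properties using (_∈?_; x∈p∧x≢y⇒x∈p-y; x∈p⇒∣p-x∣<∣p∣; ∈⊤; p─q⊆p)
open import Data.List.Base using (List; []; _∷_; map; filter; foldr; allFin; cartesianProduct)
open import Data.List.Membership.Propositional using () renaming (_∈_ to _∈ˡ_; _∉_ to _∉ˡ_)
open import Data.List.Membership.Propositional.Properties
  using (∈-allFin; ∈-cartesianProduct⁺; ∈-filter⁺)
open import Data.List.Relation.Unary.All as All using (All; []; _∷_)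
import Data.List.Relation.Unary.All.Properties as All
open import Data.List.Relation.Unary.AllPairs using ([]; _∷_)
open import Data.List.Relation.Unary.Any using (here; there)
open import Data.List.Relation.Unary.Unique.Propositional using (Unique)
import Data.List.Relation.Unary.Unique.Propositional.Properties as Unique
open import Data.Nat.Base as ℕ using (ℕ; zero; suc)
import Data.Nat.Properties as ℕ
open import Data.Product.Base using (∃-syntax; _×_; _,_; proj₁; proj₂)
open import Data.Product.Properties using (≡-dec)
open import Data.Vec.Base using ([]; _∷_; here; there)
open import Data.Vec.Functional as Vector using (Vector)
open import Function.Base using (_∘_)
open import Level using (_⊔_; 0ℓ)
open import Relation.Binary.Core using (Rel)
open import Relation.Binary.Definitions using (Decidable; Symmetric; tri<; tri≈; tri>)
open import Relation.Binary.PropositionalEquality.Core as ≡ using (_≡_; _≢_)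
import Relation.Binary.Reasoning.Setoid as SetoidReasoning
open import Relation.Nullary.Decidable
  using (Dec; does; yes; no; ¬?; _×-dec_; decidable-stable; dec-true; dec-false)
open import Relation.Nullary.Negation using (¬_)
open import Relation.Unary as Unary using (Pred)
open import Defs

-- Evaluation of polynomials

-- The central argument runs over a commutative ring with elements x_u, regular differences x_u -
-- x_v and endomorphisms x_u ↦ x_v. Divisibility by x_u - x_v becomes an equation, vanishing under
-- x_u ↦ x_v, and regularity of an image under x_u ↦ x_v plays the role of coprimality to x_u - x_v.
-- The two kinds of congruence on h come from comparing Q with Δ_u. Write ω = η / Q, so that h_u Q =
-- η_u Δ_u. Along a nonedge uv only Δ_u vanishes, which forces h_u ≡ 0. Along an edge both Q and Δ_u
-- vanish, and the common factor has to be cancelled before substituting. Since Δ_u contains x_v -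
-- x_u and Δ_v contains x_u - x_v, the logarithmic condition η_v ≡ -η_u then turns into h_u ≡ h_v.
-- Deleting the edges at p is legitimate once h_p = 0: a former neighbour v satisfies h_v ≡ h_p = 0
-- modulo x_v - x_p, the condition for a nonedge, and every clique of the smaller graph is a clique
-- of the larger one.

IsHomomorphism : ∀ {a ℓa b ℓb} (R : CommutativeRing a ℓa) (T : CommutativeRing b ℓb) →
  (CommutativeRing.Carrier R → CommutativeRing.Carrier T) → Set (a ⊔ ℓa ⊔ ℓb)
IsHomomorphism R T = IsRingHomomorphism (CommutativeRing.rawRing R) (CommutativeRing.rawRing T)

module _ {a ℓa b ℓb} (R : CommutativeRing a ℓa) (T : CommutativeRing b ℓb) where
  private
    module R = CommutativeRing R
    module T = CommutativeRing T
  open GroupProperties T.+-group using (identityˡ-unique; inverseˡ-unique)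

  isHomomorphism : (f : R.Carrier → T.Carrier) →
    (∀ {x y} → x R.≈ y → f x T.≈ f y) →
    (∀ x y → f (x R.+ y) T.≈ f x T.+ f y) →
    (∀ x y → f (x R.* y) T.≈ f x T.* f y) →
    f R.1# T.≈ T.1# → IsHomomorphism R T f
  isHomomorphism f cong +-homo *-homo 1-homo = record
    { isSemiringHomomorphism = record
      { isNearSemiringHomomorphism = record
        { +-isMonoidHomomorphism = record
          { isMagmaHomomorphism = record
            { isRelHomomorphism = record { cong = cong }
            ; homo = +-homo }
          ; ε-homo = f0≈0 }
        ; *-homo = *-homo }
      ; 1#-homo = 1-homo }
    ; -‿homo = λ x → inverseˡ-unique (f (R.- x)) (f x)
        (T.trans (T.sym (+-homo (R.- x) x)) (T.trans (cong (R.-‿inverseˡ x)) f0≈0)) }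
    where
    f0≈0 : f R.0# T.≈ T.0#
    f0≈0 = identityˡ-unique (f R.0#) (f R.0#)
      (T.trans (T.sym (+-homo R.0# R.0#)) (cong (R.+-identityˡ R.0#)))

module _ {a ℓa b ℓb} {R : CommutativeRing a ℓa} {T : CommutativeRing b ℓb} where
  private
    module R = CommutativeRing R
    module T = CommutativeRing T
  open Univariate R

  module _ {h : R.Carrier → T.Carrier} (h-hom : IsHomomorphism R T h) (t : T.Carrier) where
    open IsRingHomomorphism h-hom
    open CommutativeRing T hiding (zero)
    open SemiringIdentities T using (interchange)
    open import Algebra.Properties.CommutativeSemigroup *-commutativeSemigroup using (x∙yz≈y∙xz)
    open SetoidReasoning setoid

    evaluate : Poly → Carrier
    evaluate []      = 0#
    evaluate (a ∷ p) = h a + t * evaluate p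

    -- Equality of polynomials ignores trailing zeros, so a non-empty list can equal `[]`; this is
    -- the case of `evaluate-cong` where the lengths differ.
    evaluate-zero : ∀ p → p ≈ᵖ [] → evaluate p ≈ 0#
    evaluate-zero []      p≈0 = refl
    evaluate-zero (a ∷ p) (mk≈ᵖ p≈0) = begin
      h a + t * evaluate p  ≈⟨ +-cong (trans (⟦⟧-cong (p≈0 0)) 0#-homo)
                                      (*-congˡ (evaluate-zero p (mk≈ᵖ (p≈0 ∘ suc)))) ⟩
      0# + t * 0#           ≈⟨ +-identityˡ _ ⟩
      t * 0#                ≈⟨ zeroʳ t ⟩
      0#                    ∎

    evaluate-cong : ∀ {p q} → p ≈ᵖ q → evaluate p ≈ evaluate q
    evaluate-cong {p}     {[]}    e = evaluate-zero p e
    evaluate-cong {[]}    {b ∷ q} e = sym (evaluate-zero (b ∷ q) (≈ᵖ-sym e))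
    evaluate-cong {a ∷ p} {b ∷ q} (mk≈ᵖ e) =
      +-cong (⟦⟧-cong (e 0)) (*-congˡ (evaluate-cong {p} {q} (mk≈ᵖ (e ∘ suc))))

    evaluate-+ : ∀ p q → evaluate (p +ᵖ q) ≈ evaluate p + evaluate q
    evaluate-+ []      q       = sym (+-identityˡ _)
    evaluate-+ (a ∷ p) []      = sym (+-identityʳ _)
    evaluate-+ (a ∷ p) (b ∷ q) = begin
      h (a R.+ b) + t * evaluate (p +ᵖ q)
        ≈⟨ +-cong (+-homo a b) (trans (*-congˡ (evaluate-+ p q)) (distribˡ t _ _)) ⟩
      (h a + h b) + (t * evaluate p + t * evaluate q)
        ≈⟨ interchange _ _ _ _ ⟩
      evaluate (a ∷ p) + evaluate (b ∷ q) ∎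

    evaluate-scale : ∀ a p → evaluate (scale a p) ≈ h a * evaluate p
    evaluate-scale a []      = sym (zeroʳ _)
    evaluate-scale a (b ∷ p) = begin
      h (a R.* b) + t * evaluate (scale a p)
        ≈⟨ +-cong (*-homo a b) (trans (*-congˡ (evaluate-scale a p)) (x∙yz≈y∙xz t (h a) _)) ⟩
      h a * h b + h a * (t * evaluate p)
        ≈⟨ distribˡ (h a) _ _ ⟨
      h a * evaluate (b ∷ p) ∎

    evaluate-* : ∀ p q → evaluate (p *ᵖ q) ≈ evaluate p * evaluate q
    evaluate-* []      q = sym (zeroˡ _)
    evaluate-* (a ∷ p) q = begin
      evaluate (scale a q +ᵖ (R.0# ∷ p *ᵖ q))
        ≈⟨ evaluate-+ (scale a q) (R.0# ∷ p *ᵖ q) ⟩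
      evaluate (scale a q) + (h R.0# + t * evaluate (p *ᵖ q))
        ≈⟨ +-cong (evaluate-scale a q) (trans (+-congʳ 0#-homo) (+-identityˡ _)) ⟩
      h a * evaluate q + t * evaluate (p *ᵖ q)
        ≈⟨ +-congˡ (trans (*-congˡ (evaluate-* p q)) (sym (*-assoc t _ _))) ⟩
      h a * evaluate q + (t * evaluate p) * evaluate q
        ≈⟨ distribʳ _ _ _ ⟨
      evaluate (a ∷ p) * evaluate q ∎

    evaluate-const : ∀ a → evaluate (const a) ≈ h a
    evaluate-const a = trans (+-congˡ (zeroʳ t)) (+-identityʳ _)

    evaluate-var : evaluate var ≈ t
    evaluate-var = begin
      h R.0# + t * evaluate (const R.1#)  ≈⟨ +-cong 0#-homo (*-congˡ (evaluate-const R.1#)) ⟩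
      0# + t * h R.1#                     ≈⟨ +-identityˡ _ ⟩
      t * h R.1#                          ≈⟨ *-congˡ 1#-homo ⟩
      t * 1#                              ≈⟨ *-identityʳ t ⟩
      t                                   ∎

    evaluate-isHomomorphism : IsHomomorphism polynomials T evaluate
    evaluate-isHomomorphism = isHomomorphism polynomials T evaluate evaluate-cong evaluate-+ evaluate-*
      (trans (evaluate-const R.1#) 1#-homo)

module _ {a ℓa} (R : CommutativeRing a ℓa) where
  open Univariate R
  private
    module R = CommutativeRing R
    module R[x] = CommutativeRing polynomials

  const-isHomomorphism : IsHomomorphism R polynomials const
  const-isHomomorphism =
    isHomomorphism R polynomials const const-cong (λ _ _ → ≈ᵖ-refl)
      (λ a b → ≈ᵖ-sym (const-* a b)) ≈ᵖ-refl

  horner : ∀ a p → (a ∷ p) ≈ᵖ (const a +ᵖ var *ᵖ p)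
  horner a p = R[x].sym (R[x].trans
    (R[x].+-congˡ {const a}
      (+ᵖ-cong (scale-0 p) (∷-cong R.refl (R[x].*-identityˡ p))))
    (∷-cong (R.+-identityʳ a) ≈ᵖ-refl))

module _ {a ℓa b ℓb} {R : CommutativeRing a ℓa} {T : CommutativeRing b ℓb} where
  private
    module R = CommutativeRing R
    module T = CommutativeRing T
  open Multivariate R

  -- Defined together with its homomorphism property, because `evaluate` takes the proof for the
  -- inner ring as an argument.
  evaluateAt : {h : R.Carrier → T.Carrier} → IsHomomorphism R T h →
    ∀ {n} → Vector T.Carrier n → Polynomial n → T.Carrier
  evaluateAt-isHomomorphism : {h : R.Carrier → T.Carrier} (h-hom : IsHomomorphism R T h) →
    ∀ {n} (t : Vector T.Carrier n) → IsHomomorphism (polynomialRing n) T (evaluateAt h-hom t)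

  evaluateAt {h} h-hom {zero}  t = h
  evaluateAt     h-hom {suc n} t =
    evaluate {R = polynomialRing n} {T = T} (evaluateAt-isHomomorphism h-hom (t ∘ suc)) (t zero)

  evaluateAt-isHomomorphism h-hom {zero}  t = h-hom
  evaluateAt-isHomomorphism h-hom {suc n} t =
    evaluate-isHomomorphism {R = polynomialRing n} {T = T}
      (evaluateAt-isHomomorphism h-hom (t ∘ suc)) (t zero)

  module _ {h : R.Carrier → T.Carrier} (h-hom : IsHomomorphism R T h) where

    evaluateAt-constant : ∀ {n} (t : Vector T.Carrier n) a →
      evaluateAt h-hom t (constant n a) T.≈ h a
    evaluateAt-constant {zero}  t a = T.refl
    evaluateAt-constant {suc n} t a =
      T.trans
        (evaluate-const {R = polynomialRing n} {T = T}
          (evaluateAt-isHomomorphism h-hom (t ∘ suc)) (t zero) _)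
        (evaluateAt-constant (t ∘ suc) a)

    evaluateAt-x : ∀ {n} (t : Vector T.Carrier n) i → evaluateAt h-hom t x[ i ] T.≈ t i
    evaluateAt-x {suc n} t zero    =
      evaluate-var {R = polynomialRing n} {T = T}
        (evaluateAt-isHomomorphism h-hom (t ∘ suc)) (t zero)
    evaluateAt-x {suc n} t (suc i) =
      T.trans
        (evaluate-const {R = polynomialRing n} {T = T}
          (evaluateAt-isHomomorphism h-hom (t ∘ suc)) (t zero) _)
        (evaluateAt-x (t ∘ suc) i)

  module _ (d : T.Carrier) where
    open CommutativeRing T hiding (zero)
    open SetoidReasoning setoid
    open import Algebra.Solver.Ring.NaturalCoefficients.Default commutativeSemiring
      using (solve; _:+_; _:*_; _:=_)

    -- Congruence modulo d, stated without subtraction so that the semiring solver applies.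
    infix 4 _≡ᵈ_
    _≡ᵈ_ : Carrier → Carrier → Set (b ⊔ ℓb)
    a ≡ᵈ b = ∃[ k ] a ≈ b + d * k

    ≡ᵈ-resp : ∀ {x y x′ y′} → x ≈ x′ → y ≈ y′ → x ≡ᵈ y → x′ ≡ᵈ y′
    ≡ᵈ-resp x≈x′ y≈y′ (k , e) = k , trans (sym x≈x′) (trans e (+-congʳ y≈y′))

    ≈⇒≡ᵈ : ∀ {x y} → x ≈ y → x ≡ᵈ y
    ≈⇒≡ᵈ x≈y = 0# , trans x≈y (sym (trans (+-congˡ (zeroʳ d)) (+-identityʳ _)))

    ≡ᵈ-+ : ∀ {x y z w} → x ≡ᵈ y → z ≡ᵈ w → x + z ≡ᵈ y + w
    ≡ᵈ-+ {x} {y} {z} {w} (k , e) (l , f) = k + l , trans (+-cong e f)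
      (solve 5 (λ y w d k l → (y :+ d :* k) :+ (w :+ d :* l) := (y :+ w) :+ d :* (k :+ l))
        refl y w d k l)

    ≡ᵈ-* : ∀ {x y z w} → x ≡ᵈ y → z ≡ᵈ w → x * z ≡ᵈ y * w
    ≡ᵈ-* {x} {y} {z} {w} (k , e) (l , f) = y * l + k * (w + d * l) , trans (*-cong e f)
      (solve 5 (λ y w d k l → (y :+ d :* k) :* (w :+ d :* l) :=
                              (y :* w) :+ d :* (y :* l :+ k :* (w :+ d :* l)))
        refl y w d k l)

    -- Polynomials arise from constants and variables by sums and products, and congruence modulo
    -- `d` respects both. The outer induction is on the number of variables, the inner one on the
    -- coefficient list in Horner form. With the identity for `f` and a substitution for `g` this
    -- yields quotients by x_u - x_v.
    homomorphisms-congruent : ∀ n {f g : Polynomial n → Carrier} →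
      IsHomomorphism (polynomialRing n) T f → IsHomomorphism (polynomialRing n) T g →
      (∀ a → f (constant n a) ≡ᵈ g (constant n a)) → (∀ i → f (x[_] {n} i) ≡ᵈ g (x[_] {n} i)) →
      ∀ p → f p ≡ᵈ g p
    homomorphisms-congruent zero    f-hom g-hom f-const f-x p = f-const p
    homomorphisms-congruent (suc n) {f} {g} f-hom g-hom f-const f-x = go
      where
      module f = IsRingHomomorphism f-hom
      module g = IsRingHomomorphism g-hom
      open Univariate (polynomialRing n)

      const-hom : IsHomomorphism (polynomialRing n) (polynomialRing (suc n)) const
      const-hom = const-isHomomorphism (polynomialRing n)

      on-const : ∀ a → f (const a) ≡ᵈ g (const a)
      on-const = homomorphisms-congruent n
        (Composition.isRingHomomorphism trans const-hom f-hom)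
        (Composition.isRingHomomorphism trans const-hom g-hom)
        f-const (f-x ∘ suc)

      split : ∀ {h} → IsHomomorphism (polynomialRing (suc n)) T h → ∀ a p →
        h (const a) + h var * h p ≈ h (a ∷ p)
      split {h} h-hom a p = sym (begin
        h (a ∷ p)                    ≈⟨ h.⟦⟧-cong (horner (polynomialRing n) a p) ⟩
        h (const a +ᵖ var *ᵖ p)      ≈⟨ h.+-homo _ _ ⟩
        h (const a) + h (var *ᵖ p)   ≈⟨ +-congˡ (h.*-homo _ _) ⟩
        h (const a) + h var * h p    ∎)
        where module h = IsRingHomomorphism h-hom

      go : ∀ p → f p ≡ᵈ g p
      go []      = ≈⇒≡ᵈ (trans f.0#-homo (sym g.0#-homo))
      go (a ∷ p) = ≡ᵈ-resp (split f-hom a p) (split g-hom a p)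
        (≡ᵈ-+ (on-const a) (≡ᵈ-* (f-x zero) (go p)))

module _ {c ℓ} (R : CommutativeRing c ℓ) where
  open Multivariate R

  constant-isHomomorphism : ∀ n → IsHomomorphism R (polynomialRing n) (constant n)
  constant-isHomomorphism zero    = Identity.isRingHomomorphism _ (CommutativeRing.refl R)
  constant-isHomomorphism (suc n) = Composition.isRingHomomorphism
    (CommutativeRing.trans (polynomialRing (suc n)))
    (constant-isHomomorphism n) (const-isHomomorphism (polynomialRing n))

-- Products over lists

module _ {p} {P : Set p} where

  if-true : (P? : Dec P) → P → ∀ {a} {A : Set a} {x y : A} → (if does P? then x else y) ≡ x
  if-true P? p rewrite dec-true P? p = ≡.refl

  if-false : (P? : Dec P) → ¬ P → ∀ {a} {A : Set a} {x y : A} → (if does P? then x else y) ≡ y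
  if-false P? ¬p rewrite dec-false P? ¬p = ≡.refl

  if-elim : ∀ {a b} {A : Set a} (B : A → Set b) (P? : Dec P) → ∀ {x y} →
    (P → B x) → (¬ P → B y) → B (if does P? then x else y)
  if-elim B (yes p) f g = f p
  if-elim B (no ¬p) f g = g ¬p

x∉p∖x : ∀ {n} (p : Subset n) x → x ∉ p ∖ x
x∉p∖x (inside  ∷ p) zero    ()
x∉p∖x (outside ∷ p) zero    ()
x∉p∖x (inside  ∷ p) (suc x) (there x∈) = x∉p∖x p x x∈
x∉p∖x (outside ∷ p) (suc x) (there x∈) = x∉p∖x p x x∈

module Products {c ℓ} (R : CommutativeRing c ℓ) where
  open CommutativeRing R hiding (zero)
  open NonZeroDivisors R
  open SemiringIdentities R using (cross)
  open import Algebra.Properties.CommutativeSemigroup *-commutativeSemigroup using (x∙yz≈y∙xz)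
  open import Algebra.Properties.Semiring.Divisibility semiring public
    using (_∣_; _,_; ∣-respʳ-≈)
  open SetoidReasoning setoid

  module _ {i} {I : Set i} where

    ∏-cong : ∀ {f g : I → Carrier} (L : List I) → (∀ i → f i ≈ g i) → ∏ (map f L) ≈ ∏ (map g L)
    ∏-cong []      e = refl
    ∏-cong (i ∷ L) e = *-cong (e i) (∏-cong L e)

    ∏-1 : ∀ {f : I → Carrier} (L : List I) → (∀ i → f i ≈ 1#) → ∏ (map f L) ≈ 1#
    ∏-1 []      e = refl
    ∏-1 (i ∷ L) e = trans (*-cong (e i) (∏-1 L e)) (*-identityˡ 1#)

    ∏-* : ∀ (f g : I → Carrier) (L : List I) →
      ∏ (map (λ i → f i * g i) L) ≈ ∏ (map f L) * ∏ (map g L)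
    ∏-* f g []      = sym (*-identityˡ 1#)
    ∏-* f g (i ∷ L) = trans (*-congˡ (∏-* f g L)) (cross _ _ _ _)

    ∏-filter : ∀ {p} {P : Pred I p} (P? : Unary.Decidable P) (f : I → Carrier) (L : List I) →
      ∏ (map f (filter P? L)) ≈ ∏ (map (λ i → if does (P? i) then f i else 1#) L)
    ∏-filter P? f []      = refl
    ∏-filter P? f (i ∷ L) with P? i
    ... | yes _ = *-congˡ (∏-filter P? f L)
    ... | no  _ = trans (∏-filter P? f L) (sym (*-identityˡ _))

    ∏-regular : ∀ {f : I → Carrier} (L : List I) → (∀ i → Regular (f i)) → Regular (∏ (map f L))
    ∏-regular L r = regular-∏ (All.map⁺ (All.universal r L))

    -- Partial products are written over the full index list with factor 1 at the omitted indices,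
    -- so inserting or removing a factor changes the product at a single index.
    ∏-update : ∀ {a} {f g : I → Carrier} {i} {L : List I} → Unique L → i ∈ˡ L →
      (∀ j → j ≢ i → g j ≈ f j) → g i ≈ a * f i → ∏ (map g L) ≈ a * ∏ (map f L)
    ∏-update {a} {f} {g} {i} {_ ∷ L} (i∉L ∷ _) (here ≡.refl) off on = begin
      g i * ∏ (map g L)        ≈⟨ *-cong on (unchanged i∉L) ⟩
      (a * f i) * ∏ (map f L)  ≈⟨ *-assoc _ _ _ ⟩
      a * (f i * ∏ (map f L))  ∎
      where
      unchanged : ∀ {L} → All (i ≢_) L → ∏ (map g L) ≈ ∏ (map f L)
      unchanged []           = refl
      unchanged (i≢j ∷ i∉L)  = *-cong (off _ (i≢j ∘ ≡.sym)) (unchanged i∉L)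
    ∏-update {a} {f} {g} {i} {j ∷ L} (j∉L ∷ u) (there i∈L) off on = begin
      g j * ∏ (map g L)        ≈⟨ *-cong (off j (All.lookup j∉L i∈L)) (∏-update u i∈L off on) ⟩
      f j * (a * ∏ (map f L))  ≈⟨ x∙yz≈y∙xz _ _ _ ⟩
      a * (f j * ∏ (map f L))  ∎

    -- Coprimality is stated as the cancellation property that the induction consumes: after
    -- dividing `z` by the first factor, the remaining ones still divide the quotient.
    ∏-∣ : ∀ {f : I → Carrier} {L : List I} → Unique L →
      (∀ {i j} z → i ≢ j → f j ∣ f i * z → f j ∣ z) →
      ∀ {z} → (∀ i → f i ∣ z) → ∏ (map f L) ∣ z
    ∏-∣ {f} {L} u coprime {z} f∣z = go u (All.universal f∣z L)
      where
      go : ∀ {z L} → Unique L → All (λ i → f i ∣ z) L → ∏ (map f L) ∣ z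
      go {z} [] [] = z , *-identityʳ z
      go {z} {i ∷ L} (i∉L ∷ u) ((q , qfᵢ≈z) ∷ L∣z) =
        let r , r∏≈q = go u (All.zipWith (λ (i≢j , fⱼ∣z) →
              coprime q i≢j (∣-respʳ-≈ (trans (sym qfᵢ≈z) (*-comm q (f i))) fⱼ∣z)) (i∉L , L∣z))
        in r , (begin
          r * (f i * ∏ (map f L))  ≈⟨ x∙yz≈y∙xz _ _ _ ⟩
          f i * (r * ∏ (map f L))  ≈⟨ *-congˡ r∏≈q ⟩
          f i * q                  ≈⟨ *-comm _ _ ⟩
          q * f i                  ≈⟨ qfᵢ≈z ⟩
          z                        ∎)

module _ {c ℓ c′ ℓ′} {R : CommutativeRing c ℓ} {T : CommutativeRing c′ ℓ′} where
  private
    module R = CommutativeRing R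
    module T = CommutativeRing T
    module RN = NonZeroDivisors R
    module TN = NonZeroDivisors T

  ∏-homo : ∀ {h : R.Carrier → T.Carrier} → IsHomomorphism R T h →
    ∀ {i} {I : Set i} (f : I → R.Carrier) (L : List I) →
    h (RN.∏ (map f L)) T.≈ TN.∏ (map (h ∘ f) L)
  ∏-homo h-hom f []      = IsRingHomomorphism.1#-homo h-hom
  ∏-homo h-hom f (i ∷ L) =
    T.trans (IsRingHomomorphism.*-homo h-hom _ _) (T.*-congˡ (∏-homo h-hom f L))

-- Substitutions identifying two variables

module _ {c ℓ} (S : CommutativeRing c ℓ) (n : ℕ) where
  open CommutativeRing S hiding (zero)

  -- φ u v plays the role of the substitution x_u ↦ x_v.
  module Substitutions
    (x : Fin n → Carrier)
    (x-regular : ∀ {u v} → u ≢ v → NonZeroDivisors.Regular S (x u - x v))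
    (φ : Fin n → Fin n → Carrier → Carrier)
    (φ-homo : ∀ u v → IsHomomorphism S S (φ u v))
    (φ-x-source : ∀ u v → φ u v (x u) ≈ x v)
    (φ-x-other : ∀ {u v w} → w ≢ u → φ u v (x w) ≈ x w)
    (φ-modulo : ∀ u v a → ∃[ k ] a ≈ φ u v a + (x u - x v) * k)
    where
    open NonZeroDivisors S
    open Products S
    open RingProperties ring
    open SemiringIdentities S using (interchange)
    open import Algebra.Properties.CommutativeSemigroup *-commutativeSemigroup using (x∙yz≈y∙xz)
    open SetoidReasoning setoid
    private module φ u v = IsRingHomomorphism (φ-homo u v)

    x-x≈0 : ∀ {a b} → a ≈ b → a - b ≈ 0#
    x-x≈0 = x≈y⇒x∙y⁻¹≈ε

    δ : Fin n → Fin n → Carrier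
    δ u v = x u - x v

    φ-target : ∀ u v → φ u v (x v) ≈ x v
    φ-target u v with v ≟ u
    ... | yes ≡.refl = φ-x-source u u
    ... | no v≢u     = φ-x-other v≢u

    φ-minus : ∀ u v a b → φ u v (a - b) ≈ φ u v a - φ u v b
    φ-minus u v a b = trans (φ.+-homo u v a (- b)) (+-congˡ (φ.-‿homo u v b))

    φ-δ : ∀ u v → φ u v (δ u v) ≈ 0#
    φ-δ u v = trans (φ-minus u v _ _) (x-x≈0 (trans (φ-x-source u v) (sym (φ-target u v))))

    φ-δ-flip : ∀ u v → φ v u (δ u v) ≈ 0#
    φ-δ-flip u v = trans (φ-minus v u _ _) (x-x≈0 (trans (φ-target v u) (sym (φ-x-source v u))))

    -- `φ v u` kills `δ u v`, hence depends only on the class of `a` modulo x_u - x_v, and `φ u v a`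
    -- lies in that class.
    φ-absorb : ∀ u v a → φ v u a ≈ φ v u (φ u v a)
    φ-absorb u v a = let k , a≈ = φ-modulo u v a in begin
      φ v u a                                       ≈⟨ φ.⟦⟧-cong v u a≈ ⟩
      φ v u (φ u v a + δ u v * k)                   ≈⟨ φ.+-homo v u _ _ ⟩
      φ v u (φ u v a) + φ v u (δ u v * k)           ≈⟨ +-congˡ (φ.*-homo v u _ _) ⟩
      φ v u (φ u v a) + φ v u (δ u v) * φ v u k     ≈⟨ +-congˡ (*-congʳ (φ-δ-flip u v)) ⟩
      φ v u (φ u v a) + 0# * φ v u k                ≈⟨ +-congˡ (zeroˡ _) ⟩
      φ v u (φ u v a) + 0#                          ≈⟨ +-identityʳ _ ⟩
      φ v u (φ u v a)                               ∎

    -- Edges are unordered while substitutions are directed; this transfers every congruence modulo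
    -- x_u - x_v to the reversed pair.
    φ-flip : ∀ {u v a b} → φ u v a ≈ φ u v b → φ v u a ≈ φ v u b
    φ-flip {u} {v} {a} {b} e =
      trans (φ-absorb u v a) (trans (φ.⟦⟧-cong v u e) (sym (φ-absorb u v b)))

    φ-flip-0 : ∀ {u v a} → φ u v a ≈ 0# → φ v u a ≈ 0#
    φ-flip-0 {u} {v} e = trans (φ-flip (trans e (sym (φ.0#-homo u v)))) (φ.0#-homo v u)

    φ≈0⇒δ∣ : ∀ {u v a} → φ u v a ≈ 0# → δ u v ∣ a
    φ≈0⇒δ∣ {u} {v} {a} e = let k , a≈ = φ-modulo u v a in k , (begin
      k * δ u v                ≈⟨ *-comm _ _ ⟩
      δ u v * k                ≈⟨ +-identityˡ _ ⟨
      0# + δ u v * k           ≈⟨ +-congʳ e ⟨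
      φ u v a + δ u v * k      ≈⟨ a≈ ⟨
      a                        ∎)

    φ-∣ : ∀ {u v a b} → φ u v a ≈ 0# → a ∣ b → φ u v b ≈ 0#
    φ-∣ {u} {v} {a} {b} e (q , qa≈b) = begin
      φ u v b              ≈⟨ φ.⟦⟧-cong u v qa≈b ⟨
      φ u v (q * a)        ≈⟨ φ.*-homo u v q a ⟩
      φ u v q * φ u v a    ≈⟨ *-congˡ e ⟩
      φ u v q * 0#         ≈⟨ zeroʳ _ ⟩
      0#                   ∎

    δ∣⇒φ≈0 : ∀ {u v a} → δ u v ∣ a → φ u v a ≈ 0#
    δ∣⇒φ≈0 {u} {v} = φ-∣ (φ-δ u v)

    δ∣-flip : ∀ {u v a} → δ u v ∣ a → δ v u ∣ a
    δ∣-flip = φ≈0⇒δ∣ ∘ φ-flip-0 ∘ δ∣⇒φ≈0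

    -- Regularity of `φ u v b` says that `b` is a non-zero-divisor modulo x_u - x_v, the kernel of
    -- `φ u v` being generated by that difference.
    δ∣-cancel : ∀ {u v b} → Regular (φ u v b) → ∀ z → δ u v ∣ b * z → δ u v ∣ z
    δ∣-cancel {u} {v} rb z δ∣bz =
      φ≈0⇒δ∣ (rb _ (trans (sym (φ.*-homo u v _ z)) (δ∣⇒φ≈0 δ∣bz)))

    -- The substitution x_u ↦ x_v identifies no two distinct variables other than x_u and x_v, so
    -- the image is again a difference of distinct variables.
    regular-φ-δ : ∀ {u v a b} → a ≢ b → ¬ (a ≡ u × b ≡ v) → ¬ (a ≡ v × b ≡ u) →
      Regular (φ u v (δ a b))
    regular-φ-δ {u} {v} {a} {b} a≢b ≢uv ≢vu with a ≟ u | b ≟ u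
    ... | yes ≡.refl | yes ≡.refl = ⊥-elim (a≢b ≡.refl)
    ... | yes ≡.refl | no b≢u = regular-resp
      (sym (trans (φ-minus u v _ _) (+-cong (φ-x-source u v) (-‿cong (φ-x-other b≢u)))))
      (x-regular (λ v≡b → ≢uv (≡.refl , ≡.sym v≡b)))
    ... | no a≢u | yes ≡.refl = regular-resp
      (sym (trans (φ-minus u v _ _) (+-cong (φ-x-other a≢u) (-‿cong (φ-x-source u v)))))
      (x-regular (λ a≡v → ≢vu (a≡v , ≡.refl)))
    ... | no a≢u | no b≢u = regular-resp
      (sym (trans (φ-minus u v _ _) (+-cong (φ-x-other a≢u) (-‿cong (φ-x-other b≢u)))))
      (x-regular a≢b)

    complementFactor : Subset n → Fin n → Fin n → Carrier
    complementFactor F i j = if does (j ∈? F) then 1# else δ j i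

    -- The vector e_F of the overview. Since the index j = i is not skipped, the coordinates outside
    -- F vanish without a case distinction.
    complementProduct : Subset n → Vector Carrier n
    complementProduct F i = ∏ (map (complementFactor F i) (allFin n))

    -- Vectors compatible with a graph

    -- The span of the clique vectors is handled as an arbitrary submodule containing them, so that
    -- the induction can intersect it with further linear conditions.
    record IsSubmodule {m} (M : Pred (Vector Carrier n) m) : Set (c ⊔ ℓ ⊔ m) where
      field
        resp     : ∀ {h k} → (∀ i → h i ≈ k i) → M h → M k
        0-closed : M (λ _ → 0#)
        +-closed : ∀ {h k} → M h → M k → M (λ i → h i + k i)
        •-closed : ∀ a {h} → M h → M (λ i → a * h i)

    module _ (E : Rel (Fin n) 0ℓ) where

      Clique : Pred (Subset n) 0ℓ
      Clique F = ∀ {u v} → u ∈ F → v ∈ F → u ≢ v → E u v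

      record Compatible (h : Vector Carrier n) : Set ℓ where
        field
          edge    : ∀ {u v} → u ≢ v → E u v → φ u v (h u) ≈ φ u v (h v)
          nonedge : ∀ {u v} → u ≢ v → ¬ E u v → φ u v (h u) ≈ 0#

      compatible-isSubmodule : IsSubmodule Compatible
      compatible-isSubmodule = record
        { resp = λ h≈k H → record
            { edge = λ {u} {v} u≢v e → trans (φ.⟦⟧-cong u v (sym (h≈k u)))
                       (trans (edge H u≢v e) (φ.⟦⟧-cong u v (h≈k v)))
            ; nonedge = λ {u} {v} u≢v e → trans (φ.⟦⟧-cong u v (sym (h≈k u))) (nonedge H u≢v e) }
        ; 0-closed = record
            { edge = λ _ _ → refl
            ; nonedge = λ {u} {v} _ _ → φ.0#-homo u v }
        ; +-closed = λ H K → record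
            { edge = λ {u} {v} u≢v e → trans (φ.+-homo u v _ _)
                (trans (+-cong (edge H u≢v e) (edge K u≢v e)) (sym (φ.+-homo u v _ _)))
            ; nonedge = λ {u} {v} u≢v e → trans (φ.+-homo u v _ _)
                (trans (+-cong (nonedge H u≢v e) (nonedge K u≢v e)) (+-identityˡ 0#)) }
        ; •-closed = λ a H → record
            { edge = λ {u} {v} u≢v e → trans (φ.*-homo u v _ _)
                (trans (*-congˡ (edge H u≢v e)) (sym (φ.*-homo u v _ _)))
            ; nonedge = λ {u} {v} u≢v e → trans (φ.*-homo u v _ _)
                (trans (*-congˡ (nonedge H u≢v e)) (zeroʳ _)) }
        }
        where open Compatible

    -- The factor at j = i is x_i − x_i.
    complementProduct-∉ : ∀ F {i} → i ∉ F → complementProduct F i ≈ 0#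
    complementProduct-∉ F {i} i∉F = trans
      (∏-update {a = 0#} {g = complementFactor F i} (Unique.allFin⁺ n) (∈-allFin i)
        (λ _ _ → refl) factor≈0)
      (zeroˡ _)
      where
      factor≈0 : complementFactor F i i ≈ 0# * complementFactor F i i
      factor≈0 = trans (reflexive (if-false (i ∈? F) i∉F)) (trans (-‿inverseʳ _) (sym (zeroˡ _)))

    φ-complementFactor : ∀ {u v} F j → φ u v (complementFactor F u j) ≈ φ u v (complementFactor F v j)
    φ-complementFactor {u} {v} F j with does (j ∈? F)
    ... | true  = refl
    ... | false = trans (φ-minus u v _ _)
      (trans (+-congˡ (-‿cong (trans (φ-x-source u v) (sym (φ-target u v))))) (sym (φ-minus u v _ _)))

    φ-complementProduct : ∀ u v F → φ u v (complementProduct F u) ≈ φ u v (complementProduct F v)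
    φ-complementProduct u v F = begin
      φ u v (complementProduct F u)
        ≈⟨ ∏-homo {R = S} {T = S} (φ-homo u v) _ (allFin n) ⟩
      ∏ (map (φ u v ∘ complementFactor F u) (allFin n))
        ≈⟨ ∏-cong (allFin n) (φ-complementFactor F) ⟩
      ∏ (map (φ u v ∘ complementFactor F v) (allFin n))
        ≈⟨ ∏-homo {R = S} {T = S} (φ-homo u v) _ (allFin n) ⟨
      φ u v (complementProduct F v) ∎

    -- A clique misses an endpoint of each nonedge, where its vector vanishes; the coordinate at the
    -- other endpoint is congruent to that one.
    complementProduct-compatible : ∀ (E : Rel (Fin n) 0ℓ) F → Clique E F →
      Compatible E (complementProduct F)
    complementProduct-compatible E F clique = record
      { edge    = λ {u} {v} _ _ → φ-complementProduct u v F
      ; nonedge = nonedge }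
      where
      nonedge : ∀ {u v} → u ≢ v → ¬ E u v → φ u v (complementProduct F u) ≈ 0#
      nonedge {u} {v} u≢v ¬e with u ∈? F | v ∈? F
      ... | yes u∈F | yes v∈F = ⊥-elim (¬e (clique u∈F v∈F u≢v))
      ... | no u∉F  | _       = trans (φ.⟦⟧-cong u v (complementProduct-∉ F u∉F)) (φ.0#-homo u v)
      ... | yes _   | no v∉F  = trans (φ-complementProduct u v F)
        (trans (φ.⟦⟧-cong u v (complementProduct-∉ F v∉F)) (φ.0#-homo u v))

    complementProduct-⊤ : ∀ i → complementProduct ⊤ i ≈ 1#
    complementProduct-⊤ i = ∏-1 (allFin n) (λ j → reflexive (if-true (j ∈? ⊤) ∈⊤))

    complementProduct-remove : ∀ {T v} → v ∈ T → ∀ i →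
      complementProduct (T ∖ v) i ≈ δ v i * complementProduct T i
    complementProduct-remove {T} {v} v∈T i =
      ∏-update (Unique.allFin⁺ n) (∈-allFin v) off on
      where
      off : ∀ j → j ≢ v → complementFactor (T ∖ v) i j ≈ complementFactor T i j
      off j j≢v with j ∈? T
      ... | yes j∈T = reflexive (if-true (j ∈? (T ∖ v)) (x∈p∧x≢y⇒x∈p-y j∈T j≢v))
      ... | no  j∉T = reflexive (if-false (j ∈? (T ∖ v)) (j∉T ∘ p─q⊆p T _))
      on : complementFactor (T ∖ v) i v ≈ δ v i * complementFactor T i v
      on = trans (reflexive (if-false (v ∈? (T ∖ v)) (x∉p∖x T v)))
        (trans (sym (*-identityʳ _)) (*-congˡ (reflexive (≡.sym (if-true (v ∈? T) v∈T)))))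

    -- Ideals generated by two differences at a vertex

    module _ (p : Fin n) where

      InPairIdeal : Fin n → Fin n → Pred Carrier (c ⊔ ℓ)
      InPairIdeal v j f = ∃[ a ] ∃[ b ] f ≈ δ v p * a + δ j p * b

      pairIdeal-swap : ∀ {v j f} → InPairIdeal v j f → InPairIdeal j v f
      pairIdeal-swap (a , b , e) = b , a , trans e (+-comm _ _)

      ∣⇒pairIdeal : ∀ {v j f} → δ v p ∣ f → InPairIdeal v j f
      ∣⇒pairIdeal {v} {j} {f} (q , e) = q , 0# , (begin
        f                          ≈⟨ e ⟨
        q * δ v p                  ≈⟨ *-comm _ _ ⟩
        δ v p * q                  ≈⟨ +-identityʳ _ ⟨
        δ v p * q + 0#             ≈⟨ +-congˡ (zeroʳ _) ⟨
        δ v p * q + δ j p * 0#     ∎)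

      pairIdeal-+ : ∀ {v j f g} → InPairIdeal v j f → InPairIdeal v j g → InPairIdeal v j (f + g)
      pairIdeal-+ {v} {j} {f} {g} (a , b , e) (a′ , b′ , e′) = a + a′ , b + b′ , (begin
        f + g                                                    ≈⟨ +-cong e e′ ⟩
        (δ v p * a + δ j p * b) + (δ v p * a′ + δ j p * b′)      ≈⟨ interchange _ _ _ _ ⟩
        (δ v p * a + δ v p * a′) + (δ j p * b + δ j p * b′)      ≈⟨ +-cong (distribˡ _ _ _) (distribˡ _ _ _) ⟨
        δ v p * (a + a′) + δ j p * (b + b′)                      ∎)

      pairIdeal-neg : ∀ {v j f} → InPairIdeal v j f → InPairIdeal v j (- f)
      pairIdeal-neg {v} {j} {f} (a , b , e) = - a , - b , (begin
        - f                              ≈⟨ -‿cong e ⟩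
        - (δ v p * a + δ j p * b)        ≈⟨ -‿+-comm _ _ ⟨
        - (δ v p * a) + - (δ j p * b)    ≈⟨ +-cong (-‿distribʳ-* _ _) (-‿distribʳ-* _ _) ⟩
        δ v p * - a + δ j p * - b        ∎)

      pairIdeal-resp : ∀ {v j f g} → f ≈ g → InPairIdeal v j f → InPairIdeal v j g
      pairIdeal-resp f≈g (a , b , e) = a , b , trans (sym f≈g) e

      φ-δ-other : ∀ {v w} → v ≢ w → φ w p (δ v p) ≈ δ v p
      φ-δ-other {v} {w} v≢w =
        trans (φ-minus w p _ _) (+-cong (φ-x-other v≢w) (-‿cong (φ-target w p)))

      -- The substitution x_w ↦ x_p kills y_w and fixes every other y_v; consequently it maps each
      -- pair ideal into itself.
      φ-δ-multiple : ∀ w v → ∃[ ε ] φ w p (δ v p) ≈ δ v p * ε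
      φ-δ-multiple w v with v ≟ w
      ... | yes ≡.refl = 0# , trans (φ-δ v p) (sym (zeroʳ _))
      ... | no v≢w     = 1# , trans (φ-δ-other v≢w) (sym (*-identityʳ _))

      pairIdeal-φ : ∀ w {v j f} → InPairIdeal v j f → InPairIdeal v j (φ w p f)
      pairIdeal-φ w {v} {j} {f} (a , b , e) =
        let ε , eᵥ = φ-δ-multiple w v
            η , eⱼ = φ-δ-multiple w j
        in ε * φ w p a , η * φ w p b , (begin
          φ w p f
            ≈⟨ φ.⟦⟧-cong w p e ⟩
          φ w p (δ v p * a + δ j p * b)
            ≈⟨ φ.+-homo w p _ _ ⟩
          φ w p (δ v p * a) + φ w p (δ j p * b)
            ≈⟨ +-cong (φ.*-homo w p _ _) (φ.*-homo w p _ _) ⟩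
          φ w p (δ v p) * φ w p a + φ w p (δ j p) * φ w p b
            ≈⟨ +-cong (trans (*-congʳ eᵥ) (*-assoc _ _ _)) (trans (*-congʳ eⱼ) (*-assoc _ _ _)) ⟩
          δ v p * (ε * φ w p a) + δ j p * (η * φ w p b) ∎)

      φ-pair : ∀ {v j f} → v ≢ j → ((_ , t , _) : InPairIdeal v j f) → φ v p f ≈ δ j p * φ v p t
      φ-pair {v} {j} {f} v≢j (s , t , e) = begin
        φ v p f
          ≈⟨ φ.⟦⟧-cong v p e ⟩
        φ v p (δ v p * s + δ j p * t)
          ≈⟨ φ.+-homo v p _ _ ⟩
        φ v p (δ v p * s) + φ v p (δ j p * t)
          ≈⟨ +-cong (φ.*-homo v p _ _) (φ.*-homo v p _ _) ⟩
        φ v p (δ v p) * φ v p s + φ v p (δ j p) * φ v p t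
          ≈⟨ +-cong (trans (*-congʳ (φ-δ v p)) (zeroˡ _)) (*-congʳ (φ-δ-other (v≢j ∘ ≡.sym))) ⟩
        0# + δ j p * φ v p t
          ≈⟨ +-identityˡ _ ⟩
        δ j p * φ v p t ∎

      -- y_w is a non-zero-divisor modulo (y_v , y_j): modulo y_v the hypothesis makes y_j divide
      -- y_w times the image of `a`, and y_w is fixed by x_j ↦ x_p, hence stays regular.
      pairIdeal-cancel : ∀ {w v j a} → w ≢ p → w ≢ v → w ≢ j → v ≢ j →
        InPairIdeal v j (δ w p * a) → InPairIdeal v j a
      pairIdeal-cancel {w} {v} {j} {a} w≢p w≢v w≢j v≢j I@(_ , t , _) =
        let k , a≈ = φ-modulo v p a
            q , qδ≈ = δ∣-cancel (regular-resp (sym (φ-δ-other w≢j)) (x-regular w≢p)) (φ v p a)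
                        (φ v p t , trans (*-comm _ _) δt≈)
        in k , q , (begin
          a                          ≈⟨ a≈ ⟩
          φ v p a + δ v p * k        ≈⟨ +-comm _ _ ⟩
          δ v p * k + φ v p a        ≈⟨ +-congˡ qδ≈ ⟨
          δ v p * k + q * δ j p      ≈⟨ +-congˡ (*-comm _ _) ⟩
          δ v p * k + δ j p * q      ∎)
        where
        δt≈ : δ j p * φ v p t ≈ δ w p * φ v p a
        δt≈ = begin
          δ j p * φ v p t            ≈⟨ φ-pair v≢j I ⟨
          φ v p (δ w p * a)          ≈⟨ φ.*-homo v p _ _ ⟩
          φ v p (δ w p) * φ v p a    ≈⟨ *-congʳ (φ-δ-other w≢v) ⟩
          δ w p * φ v p a            ∎

      -- Attaining the coordinate at a vertex

      module _ {E : Rel (Fin n) 0ℓ} (E? : Decidable E) (E-sym : Symmetric E) where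

        -- The Stanley–Reisner ideal of the clique complex of E on T.
        InNonedgeIdeals : Subset n → Pred Carrier (c ⊔ ℓ)
        InNonedgeIdeals T f = ∀ {v j} → v ∈ T → j ∈ T → v ≢ j → ¬ E v j → InPairIdeal v j f

        -- If p and v are distinct neighbours and j ≠ p, then h_p ≡ h_v modulo y_v, and h_v is a
        -- multiple of x_j - x_v, which is y_j modulo y_v. In all other cases one of the two
        -- generators divides h_p.
        compatible⇒nonedgeIdeals : ∀ {h} → Compatible E h → InNonedgeIdeals ⊤ (h p)
        compatible⇒nonedgeIdeals {h} H {v} {j} _ _ v≢j ¬vj with v ≟ p | j ≟ p | E? p v
        ... | yes ≡.refl | _ | _ =
          pairIdeal-swap (∣⇒pairIdeal (δ∣-flip (φ≈0⇒δ∣ (Compatible.nonedge H v≢j ¬vj))))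
        ... | no v≢p | yes ≡.refl | _ =
          ∣⇒pairIdeal (δ∣-flip (φ≈0⇒δ∣ (Compatible.nonedge H (v≢j ∘ ≡.sym) (¬vj ∘ E-sym))))
        ... | no v≢p | no _ | no ¬pv =
          ∣⇒pairIdeal (δ∣-flip (φ≈0⇒δ∣ (Compatible.nonedge H (v≢p ∘ ≡.sym) ¬pv)))
        ... | no v≢p | no j≢p | yes pv =
          let k , h≈ = φ-modulo v p (h p)
              q , qδ≈ = δ∣-flip (φ≈0⇒δ∣ (Compatible.nonedge H v≢j ¬vj))
          in k , φ v p q , (begin
            h p
              ≈⟨ h≈ ⟩
            φ v p (h p) + δ v p * k
              ≈⟨ +-comm _ _ ⟩
            δ v p * k + φ v p (h p)
              ≈⟨ +-congˡ (Compatible.edge H v≢p (E-sym pv)) ⟨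
            δ v p * k + φ v p (h v)
              ≈⟨ +-congˡ (φ.⟦⟧-cong v p qδ≈) ⟨
            δ v p * k + φ v p (q * δ j v)
              ≈⟨ +-congˡ (trans (φ.*-homo v p _ _) (*-comm _ _)) ⟩
            δ v p * k + φ v p (δ j v) * φ v p q
              ≈⟨ +-congˡ (*-congʳ (trans (φ-minus v p _ _)
                   (+-cong (φ-x-other (v≢j ∘ ≡.sym)) (-‿cong (φ-x-source v p))))) ⟩
            δ v p * k + δ j p * φ v p q ∎)

        module _ {m} {M : Pred (Vector Carrier n) m} (M-submodule : IsSubmodule M)
          (cliques∈M : ∀ F → p ∈ F → Clique E F → M (complementProduct F)) where
          open IsSubmodule M-submodule

          Attained : Pred Carrier (c ⊔ ℓ ⊔ m)
          Attained s = ∃[ k ] M k × k p ≈ s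

          -- The bound `N` carries the recursion, since `T ∖ w` is not structurally smaller than
          -- `T`. It stops when `T` is a clique, whose own vector then does the job.
          nonedgeIdeals-attained : ∀ N {T} → ∣ T ∣ ℕ.< N → p ∈ T → ∀ f → InNonedgeIdeals T f →
            Attained (f * complementProduct T p)
          nonedgeIdeals-attained (suc N) {T} ∣T∣<N p∈T f f∈I
            with any? (λ v → any? (λ j →
              (v ∈? T) ×-dec (j ∈? T) ×-dec ¬? (v ≟ j) ×-dec ¬? (E? v j)))
          ... | no none = _ , •-closed f (cliques∈M T p∈T clique) , refl
            where
            clique : Clique E T
            clique {u} {v} u∈T v∈T u≢v =
              decidable-stable (E? u v) (λ ¬uv → none (u , v , u∈T , v∈T , u≢v , ¬uv))
          ... | yes (v , j , v∈T , j∈T , v≢j , ¬vj) =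
            -- The splitting is f = y_j · `φ v p t` + y_v · g: by `φ-pair` the image of f is a
            -- multiple of y_j, and f differs from its image by a multiple of y_v. Both parts remain
            -- in the pair ideals because `φ v p` preserves these.
            let t = proj₁ (proj₂ fᵥⱼ)
                g , f≈ = φ-modulo v p f
                φf≈ = φ-pair v≢j fᵥⱼ
                k₁ , k₁∈M , k₁p≈ = remove j (φ v p t) j∈T
                  (λ a∈ b∈ a≢b ¬ab → pairIdeal-resp φf≈ (φf∈I a∈ b∈ a≢b ¬ab))
                k₂ , k₂∈M , k₂p≈ = remove v g v∈T
                  (λ a∈ b∈ a≢b ¬ab → pairIdeal-resp (f-φf≈ f≈)
                    (pairIdeal-+ (f∈I (p─q⊆p T _ a∈) (p─q⊆p T _ b∈) a≢b ¬ab)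
                                 (pairIdeal-neg (φf∈I a∈ b∈ a≢b ¬ab))))
            in _ , +-closed k₁∈M k₂∈M , (begin
              k₁ p + k₂ p
                ≈⟨ +-cong k₁p≈ k₂p≈ ⟩
              (δ j p * φ v p t) * complementProduct T p + (δ v p * g) * complementProduct T p
                ≈⟨ distribʳ _ _ _ ⟨
              (δ j p * φ v p t + δ v p * g) * complementProduct T p
                ≈⟨ *-congʳ (trans f≈ (+-congʳ φf≈)) ⟨
              f * complementProduct T p ∎)
            where
            fᵥⱼ : InPairIdeal v j f
            fᵥⱼ = f∈I v∈T j∈T v≢j ¬vj

            φf∈I : ∀ {w} → InNonedgeIdeals (T ∖ w) (φ v p f)
            φf∈I a∈ b∈ a≢b ¬ab = pairIdeal-φ v (f∈I (p─q⊆p T _ a∈) (p─q⊆p T _ b∈) a≢b ¬ab)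

            f-φf≈ : ∀ {g} → f ≈ φ v p f + δ v p * g → f - φ v p f ≈ δ v p * g
            f-φf≈ f≈ = trans (+-congʳ f≈) (xyx⁻¹≈y _ _)

            -- The factor y_w turns e_T(p) into the coordinate for `T ∖ w`. It may be cancelled from
            -- the ideal conditions because those for `T ∖ w` involve only indices different from
            -- `w`.
            remove : ∀ w a → w ∈ T → InNonedgeIdeals (T ∖ w) (δ w p * a) →
              Attained ((δ w p * a) * complementProduct T p)
            remove w a w∈T I with w ≟ p
            -- Here y_p = 0, so the zero vector serves, and `p` never leaves `T`.
            ... | yes ≡.refl = _ , 0-closed ,
              sym (trans (*-congʳ (trans (*-congʳ (-‿inverseʳ _)) (zeroˡ _))) (zeroˡ _))
            ... | no w≢p =
              let k , k∈M , kp≈ = nonedgeIdeals-attained N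
                    (ℕ.<-≤-trans (x∈p⇒∣p-x∣<∣p∣ w∈T) (ℕ.s≤s⁻¹ ∣T∣<N))
                    (x∈p∧x≢y⇒x∈p-y p∈T (w≢p ∘ ≡.sym)) a
                    (λ a∈ b∈ a≢b ¬ab →
                      pairIdeal-cancel w≢p (≢w a∈) (≢w b∈) a≢b (I a∈ b∈ a≢b ¬ab))
              in k , k∈M , (begin
                k p                                       ≈⟨ kp≈ ⟩
                a * complementProduct (T ∖ w) p           ≈⟨ *-congˡ (complementProduct-remove w∈T p) ⟩
                a * (δ w p * complementProduct T p)       ≈⟨ x∙yz≈y∙xz _ _ _ ⟩
                δ w p * (a * complementProduct T p)       ≈⟨ *-assoc _ _ _ ⟨
                (δ w p * a) * complementProduct T p       ∎)
              where
              ≢w : ∀ {i} → i ∈ T ∖ w → w ≢ i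
              ≢w i∈ ≡.refl = x∉p∖x T w i∈

          compatible-attained : ∀ {h} → Compatible E h → Attained (h p)
          compatible-attained {h} H =
            let k , k∈M , kp≈ = nonedgeIdeals-attained (suc ∣ ⊤ {n} ∣) ℕ.≤-refl ∈⊤ (h p)
                                  (compatible⇒nonedgeIdeals H)
            in k , k∈M , trans kp≈ (trans (*-congˡ (complementProduct-⊤ p)) (*-identityʳ _))

    -- The induction is on the vertices `ps` still to be cleared. The graph shrinks along the way,
    -- hence the quantification over `E`; the last hypothesis keeps cleared vertices from being
    -- touched again.
    compatible∈span : ∀ ps {E : Rel (Fin n) 0ℓ} → Decidable E → Symmetric E →
      ∀ {m} {M : Pred (Vector Carrier n) m} → IsSubmodule M →
      (∀ F → Nonempty F → Clique E F → M (complementProduct F)) →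
      ∀ {h} → Compatible E h → (∀ i → i ∉ˡ ps → h i ≈ 0# × (∀ j → ¬ E i j)) → M h
    compatible∈span [] E? E-sym M-submodule cliques∈M H settled =
      resp (λ i → sym (proj₁ (settled i λ ()))) 0-closed
      where open IsSubmodule M-submodule
    compatible∈span (p ∷ ps) {E} E? E-sym {M = M} M-submodule cliques∈M {h} H settled =
      let k , (k∈M , K , k-isolated) , kp≈hp = compatible-attained p E? E-sym M′-submodule cliques∈M′ H
      in from-remainder k k∈M K k-isolated kp≈hp
      where
      open IsSubmodule M-submodule
      module C = IsSubmodule (compatible-isSubmodule E)

      -- A clique through `p` contains no other vertex without edges, so its vector vanishes at such
      -- vertices. Carried inside the submodule, this ensures that subtracting `k` leaves the
      -- cleared coordinates at zero.
      Isolated : Pred (Vector Carrier n) ℓ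
      Isolated k = ∀ i → i ≢ p → (∀ j → ¬ E i j) → k i ≈ 0#

      M′-submodule : IsSubmodule (λ k → M k × Compatible E k × Isolated k)
      M′-submodule = record
        { resp     = λ h≈k (m , C , I) → resp h≈k m , C.resp h≈k C ,
                       λ i i≢p e → trans (sym (h≈k i)) (I i i≢p e)
        ; 0-closed = 0-closed , C.0-closed , λ _ _ _ → refl
        ; +-closed = λ (m , C , I) (m′ , C′ , I′) → +-closed m m′ , C.+-closed C C′ ,
                       λ i i≢p e → trans (+-cong (I i i≢p e) (I′ i i≢p e)) (+-identityˡ _)
        ; •-closed = λ a (m , C , I) → •-closed a m , C.•-closed a C ,
                       λ i i≢p e → trans (*-congˡ (I i i≢p e)) (zeroʳ a) }

      cliques∈M′ : ∀ F → p ∈ F → Clique E F →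
        M (complementProduct F) × Compatible E (complementProduct F) × Isolated (complementProduct F)
      cliques∈M′ F p∈F clique = cliques∈M F (p , p∈F) clique ,
        complementProduct-compatible E F clique ,
        λ i i≢p no-edge → complementProduct-∉ F (λ i∈F → no-edge p (clique i∈F p∈F i≢p))

      E′ : Rel (Fin n) 0ℓ
      E′ u v = E u v × u ≢ p × v ≢ p

      from-remainder : ∀ k → M k → Compatible E k → Isolated k → k p ≈ h p → M h
      from-remainder k k∈M K k-isolated kp≈hp = resp restore (+-closed h′∈M k∈M)
        where
        -- The difference h - k, written with a scalar so that `+-closed` and `•-closed` apply
        -- directly.
        h′ : Vector Carrier n
        h′ i = h i + - 1# * k i

        h-k≈0 : ∀ {a b} → a ≈ b → b + - 1# * a ≈ 0#
        h-k≈0 {a} a≈b = trans (+-congˡ (-1*x≈-x a)) (x-x≈0 (sym a≈b))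

        restore : ∀ i → h′ i + k i ≈ h i
        restore i = begin
          (h i + - 1# * k i) + k i    ≈⟨ +-congʳ (+-congˡ (-1*x≈-x (k i))) ⟩
          (h i - k i) + k i           ≈⟨ +-assoc _ _ _ ⟩
          h i + (- k i + k i)         ≈⟨ +-congˡ (-‿inverseˡ _) ⟩
          h i + 0#                    ≈⟨ +-identityʳ _ ⟩
          h i                         ∎

        H′ : Compatible E h′
        H′ = C.+-closed H (C.•-closed (- 1#) K)

        φ-h′p : ∀ u v → φ u v (h′ p) ≈ 0#
        φ-h′p u v = trans (φ.⟦⟧-cong u v (h-k≈0 kp≈hp)) (φ.0#-homo u v)

        -- For a deleted edge from `u` to `p`, the old congruence gives `h′ u` ≡ `h′ p` ≈ 0.
        nonedge′ : ∀ {u v} → u ≢ v → ¬ E′ u v → φ u v (h′ u) ≈ 0#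
        nonedge′ {u} {v} u≢v ¬e′ with u ≟ p | v ≟ p | E? u v
        ... | yes ≡.refl | _ | _              = φ-h′p u v
        ... | no _       | _ | no ¬e          = Compatible.nonedge H′ u≢v ¬e
        ... | no _       | yes ≡.refl | yes e = trans (Compatible.edge H′ u≢v e) (φ-h′p u v)
        ... | no u≢p     | no v≢p | yes e     = ⊥-elim (¬e′ (e , u≢p , v≢p))

        settled′ : ∀ i → i ∉ˡ ps → h′ i ≈ 0# × (∀ j → ¬ E′ i j)
        settled′ i i∉ps with i ≟ p
        ... | yes ≡.refl = h-k≈0 kp≈hp , λ _ (_ , i≢p , _) → i≢p ≡.refl
        ... | no i≢p     =
          let hi≈0 , no-edge = settled i λ { (here i≡p) → i≢p i≡p ; (there i∈ps) → i∉ps i∈ps }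
          in h-k≈0 (trans (k-isolated i i≢p no-edge) (sym hi≈0)) , λ j (e , _) → no-edge j e

        h′∈M : M h′
        h′∈M = compatible∈span ps (λ u v → E? u v ×-dec ¬? (u ≟ p) ×-dec ¬? (v ≟ p))
          (λ (e , u≢p , v≢p) → E-sym e , v≢p , u≢p) M-submodule
          (λ F F≢∅ clique → cliques∈M F F≢∅ (λ u∈F v∈F u≢v → proj₁ (clique u∈F v∈F u≢v)))
          (record { edge = λ u≢v (e , _) → Compatible.edge H′ u≢v e ; nonedge = nonedge′ })
          settled′

    -- Numerators of logarithmic forms

    module GraphicForms {E : Rel (Fin n) 0ℓ} (E? : Decidable E) (E-sym : Symmetric E) where

      vandermondeFactor : Fin n → Fin n → Carrier
      vandermondeFactor i j = if does (j ≟ i) then 1# else δ j i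

      -- Δ_i of the overview, the denominator at dx_i of γ_F for F the full vertex set.
      vandermonde : Fin n → Carrier
      vandermonde i = ∏ (map (vandermondeFactor i) (allFin n))

      cofactorFactor : Fin n → Fin n → Fin n → Carrier
      cofactorFactor u v j = if does (j ≟ v) then 1# else vandermondeFactor u j

      -- Δ_u without its factor x_v - x_u: what is left on x_u = x_v once the common zero of Δ_u and
      -- Q has been cancelled.
      cofactor : Fin n → Fin n → Carrier
      cofactor u v = ∏ (map (cofactorFactor u v) (allFin n))

      vandermonde-cofactor : ∀ {u v} → u ≢ v → vandermonde u ≈ δ v u * cofactor u v
      vandermonde-cofactor {u} {v} u≢v = ∏-update (Unique.allFin⁺ n) (∈-allFin v)
        (λ j j≢v → reflexive (≡.sym (if-false (j ≟ v) j≢v)))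
        (trans (reflexive (if-false (v ≟ u) (u≢v ∘ ≡.sym)))
          (trans (sym (*-identityʳ _)) (*-congˡ (reflexive (≡.sym (if-true (v ≟ v) ≡.refl))))))

      vandermonde-regular : ∀ i → Regular (vandermonde i)
      vandermonde-regular i = ∏-regular (allFin n) λ j →
        if-elim Regular (j ≟ i) (λ _ → regular-1) x-regular

      regular-φ-1 : ∀ u v → Regular (φ u v 1#)
      regular-φ-1 u v = regular-resp (sym (φ.1#-homo u v)) regular-1

      regular-φ-∏ : ∀ u v {i} {I : Set i} (f : I → Carrier) L →
        (∀ i → Regular (φ u v (f i))) → Regular (φ u v (∏ (map f L)))
      regular-φ-∏ u v f L r = regular-resp
        (sym (∏-homo {R = S} {T = S} (φ-homo u v) f L)) (∏-regular L r)

      regular-φ-vandermonde : ∀ {u v i} → i ≢ u → i ≢ v → Regular (φ u v (vandermonde i))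
      regular-φ-vandermonde {u} {v} {i} i≢u i≢v = regular-φ-∏ u v _ (allFin n) λ j →
        if-elim (Regular ∘ φ u v) (j ≟ i) (λ _ → regular-φ-1 u v)
          (λ j≢i → regular-φ-δ j≢i (i≢v ∘ proj₂) (i≢u ∘ proj₂))

      regular-φ-cofactor : ∀ u v → Regular (φ u v (cofactor u v))
      regular-φ-cofactor u v = regular-φ-∏ u v _ (allFin n) λ j →
        if-elim (Regular ∘ φ u v) (j ≟ v) (λ _ → regular-φ-1 u v) λ j≢v →
        if-elim (Regular ∘ φ u v) (j ≟ u) (λ _ → regular-φ-1 u v) λ j≢u →
        regular-φ-δ j≢u (j≢u ∘ proj₁) (j≢v ∘ proj₁)

      φ-cofactor : ∀ u v → φ u v (cofactor u v) ≈ φ u v (cofactor v u)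
      φ-cofactor u v = begin
        φ u v (cofactor u v)                               ≈⟨ ∏-homo {R = S} {T = S} (φ-homo u v) _ (allFin n) ⟩
        ∏ (map (φ u v ∘ cofactorFactor u v) (allFin n))    ≈⟨ ∏-cong (allFin n) factors ⟩
        ∏ (map (φ u v ∘ cofactorFactor v u) (allFin n))    ≈⟨ ∏-homo {R = S} {T = S} (φ-homo u v) _ (allFin n) ⟨
        φ u v (cofactor v u)                               ∎
        where
        factors : ∀ j → φ u v (cofactorFactor u v j) ≈ φ u v (cofactorFactor v u j)
        factors j with j ≟ u | j ≟ v
        ... | yes _ | yes _ = refl
        ... | yes _ | no _  = refl
        ... | no _  | yes _ = refl
        ... | no _  | no _  = trans (φ-minus u v _ _)
          (trans (+-congˡ (-‿cong (trans (φ-x-source u v) (sym (φ-target u v))))) (sym (φ-minus u v _ _)))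

      φ-vandermonde-source : ∀ {u v} → u ≢ v → φ u v (vandermonde u) ≈ 0#
      φ-vandermonde-source {u} {v} u≢v =
        φ-∣ (φ-δ-flip v u) (cofactor u v , trans (*-comm _ _) (sym (vandermonde-cofactor u≢v)))

      φ-vandermonde-target : ∀ {u v} → u ≢ v → φ u v (vandermonde v) ≈ 0#
      φ-vandermonde-target {u} {v} u≢v = φ-∣ (φ-δ u v)
        (cofactor v u , trans (*-comm _ _) (sym (vandermonde-cofactor (u≢v ∘ ≡.sym))))

      Edge : Pred (Fin n × Fin n) 0ℓ
      Edge (u , v) = u < v × E u v

      edge? : Unary.Decidable Edge
      edge? (u , v) = (u <? v) ×-dec E? u v

      pairs : List (Fin n × Fin n)
      pairs = cartesianProduct (allFin n) (allFin n)

      pairs-unique : Unique pairs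
      pairs-unique = Unique.cartesianProduct⁺ (Unique.allFin⁺ n) (Unique.allFin⁺ n)

      ∈-pairs : ∀ e → e ∈ˡ pairs
      ∈-pairs (u , v) = ∈-cartesianProduct⁺ (∈-allFin u) (∈-allFin v)

      edgeFactor : Fin n × Fin n → Carrier
      edgeFactor e@(u , v) = if does (edge? e) then δ u v else 1#

      Q : Carrier
      Q = ∏ (map edgeFactor pairs)

      deletedFactor : Fin n × Fin n → Fin n × Fin n → Carrier
      deletedFactor e e′ = if does (≡-dec _≟_ _≟_ e′ e) then 1# else edgeFactor e′

      deletedQ : Fin n × Fin n → Carrier
      deletedQ e = ∏ (map (deletedFactor e) pairs)

      Q-deletedQ : ∀ {u v} → Edge (u , v) → Q ≈ δ u v * deletedQ (u , v)
      Q-deletedQ {u} {v} uv = ∏-update pairs-unique (∈-pairs (u , v))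
        (λ e e≢ → reflexive (≡.sym (if-false (≡-dec _≟_ _≟_ e (u , v)) e≢)))
        (trans (reflexive (if-true (edge? (u , v)) uv))
          (trans (sym (*-identityʳ _))
            (*-congˡ (reflexive (≡.sym (if-true (≡-dec _≟_ _≟_ (u , v) (u , v)) ≡.refl))))))

      regular-φ-edgeFactor : ∀ {u v} → Edge (u , v) → ∀ e → e ≢ (u , v) → Regular (φ u v (edgeFactor e))
      regular-φ-edgeFactor {u} {v} (u<v , _) e@(a , b) e≢uv = if-elim (Regular ∘ φ u v) (edge? e)
        (λ (a<b , _) → regular-φ-δ (<⇒≢ a<b)
          (λ { (≡.refl , ≡.refl) → e≢uv ≡.refl }) (λ { (≡.refl , ≡.refl) → <-asym u<v a<b }))
        (λ _ → regular-φ-1 u v)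

      regular-φ-deletedQ : ∀ {u v} → Edge (u , v) → Regular (φ u v (deletedQ (u , v)))
      regular-φ-deletedQ {u} {v} uv = regular-φ-∏ u v _ pairs λ e →
        if-elim (Regular ∘ φ u v) (≡-dec _≟_ _≟_ e (u , v)) (λ _ → regular-φ-1 u v)
          (regular-φ-edgeFactor uv e)

      regular-φ-Q : ∀ {u v} → ¬ E u v → Regular (φ u v Q)
      regular-φ-Q {u} {v} ¬uv = regular-φ-∏ u v _ pairs λ e → if-elim (Regular ∘ φ u v) (edge? e)
        (λ (a<b , ab) → regular-φ-δ (<⇒≢ a<b)
          (λ { (≡.refl , ≡.refl) → ¬uv ab }) (λ { (≡.refl , ≡.refl) → ¬uv (E-sym ab) }))
        (λ _ → regular-φ-1 u v)

      φ-Q-< : ∀ {u v} → Edge (u , v) → φ u v Q ≈ 0#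
      φ-Q-< {u} {v} uv = φ-∣ (φ-δ u v) (deletedQ (u , v) , trans (*-comm _ _) (sym (Q-deletedQ uv)))

      φ-Q : ∀ {u v} → u ≢ v → E u v → φ u v Q ≈ 0#
      φ-Q {u} {v} u≢v uv with <-cmp u v
      ... | tri< u<v _ _ = φ-Q-< (u<v , uv)
      ... | tri≈ _ u≡v _ = ⊥-elim (u≢v u≡v)
      ... | tri> _ _ v<u = φ-flip-0 (φ-Q-< (v<u , E-sym uv))

      -- The form η ∧ (dx_u - dx_v) vanishes on x_u = x_v exactly when η is there a multiple of dx_u
      -- - dx_v; the fields spell this out in coordinates.
      record Logarithmic (η : Vector Carrier n) : Set ℓ where
        field
          off-edge : ∀ {u v} → Edge (u , v) → ∀ {i} → i ≢ u → i ≢ v → φ u v (η i) ≈ 0#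
          on-edge  : ∀ {u v} → Edge (u , v) → φ u v (η v) ≈ - φ u v (η u)

      -- η / Q and h / vandermonde are the same rational form.
      SameForm : Rel (Vector Carrier n) ℓ
      SameForm η h = ∀ i → h i * Q ≈ η i * vandermonde i

      φ-*-0ˡ : ∀ u v {a b} → φ u v a ≈ 0# → φ u v (a * b) ≈ 0#
      φ-*-0ˡ u v e = trans (φ.*-homo u v _ _) (trans (*-congʳ e) (zeroˡ _))

      φ-*-0ʳ : ∀ u v {a b} → φ u v b ≈ 0# → φ u v (a * b) ≈ 0#
      φ-*-0ʳ u v e = trans (φ.*-homo u v _ _) (trans (*-congˡ e) (zeroʳ _))

      -- Q has to divide η_i Δ_i. The factor of an edge at i divides Δ_i, that of any other edge
      -- divides η_i by `off-edge`, and distinct edge factors are coprime.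
      logarithmic⇒numerators : ∀ {η} → Logarithmic η → ∃[ h ] SameForm η h
      logarithmic⇒numerators {η} L = proj₁ ∘ h , proj₂ ∘ h
        where
        open Logarithmic L

        divides : ∀ i e → edgeFactor e ∣ η i * vandermonde i
        divides i e@(u , v) = if-elim (_∣ η i * vandermonde i) (edge? e)
          (λ uv → φ≈0⇒δ∣ (vanishes uv (i ≟ u) (i ≟ v)))
          (λ _ → _ , *-identityʳ _)
          where
          vanishes : Edge e → Dec (i ≡ u) → Dec (i ≡ v) → φ u v (η i * vandermonde i) ≈ 0#
          vanishes (u<v , _) (yes ≡.refl) _            = φ-*-0ʳ u v (φ-vandermonde-source (<⇒≢ u<v))
          vanishes (u<v , _) (no _)       (yes ≡.refl) = φ-*-0ʳ u v (φ-vandermonde-target (<⇒≢ u<v))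
          vanishes uv        (no i≢u)     (no i≢v)     = φ-*-0ˡ u v (off-edge uv i≢u i≢v)

        coprime : ∀ {e e′} z → e ≢ e′ → edgeFactor e′ ∣ edgeFactor e * z → edgeFactor e′ ∣ z
        coprime {e} {e′} z e≢e′ = if-elim (λ a → a ∣ edgeFactor e * z → a ∣ z) (edge? e′)
          (λ uv → δ∣-cancel (regular-φ-edgeFactor uv e e≢e′) z)
          (λ _ _ → z , *-identityʳ z)

        h : ∀ i → ∃[ a ] a * Q ≈ η i * vandermonde i
        h i = let a , e = ∏-∣ pairs-unique coprime (divides i) in a , e

      -- Δ_i has to divide h_i Q. Its factor x_j - x_i divides Q when ij is an edge and h_i when it
      -- is not.
      compatible⇒numerators : ∀ {h} → Compatible E h → ∃[ η ] SameForm η h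
      compatible⇒numerators {h} H = proj₁ ∘ η , λ i → sym (proj₂ (η i))
        where
        divides : ∀ i j → vandermondeFactor i j ∣ h i * Q
        divides i j = if-elim (_∣ h i * Q) (j ≟ i) (λ _ → _ , *-identityʳ _)
          (λ j≢i → φ≈0⇒δ∣ (vanishes j≢i (E? j i)))
          where
          vanishes : j ≢ i → Dec (E j i) → φ j i (h i * Q) ≈ 0#
          vanishes j≢i (yes ji) = φ-*-0ʳ j i (φ-Q j≢i ji)
          vanishes j≢i (no ¬ji) =
            φ-*-0ˡ j i (φ-flip-0 (Compatible.nonedge H (j≢i ∘ ≡.sym) (¬ji ∘ E-sym)))

        coprime : ∀ i {j k} z → j ≢ k →
          vandermondeFactor i k ∣ vandermondeFactor i j * z → vandermondeFactor i k ∣ z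
        coprime i {j} {k} z j≢k = if-elim (λ a → a ∣ vandermondeFactor i j * z → a ∣ z) (k ≟ i)
          (λ _ _ → z , *-identityʳ z)
          (λ k≢i → δ∣-cancel (if-elim (Regular ∘ φ k i) (j ≟ i)
            (λ _ → regular-φ-1 k i)
            (λ j≢i → regular-φ-δ j≢i (j≢k ∘ proj₁) (j≢i ∘ proj₁))) z)

        η : ∀ i → ∃[ a ] a * vandermonde i ≈ h i * Q
        η i = let a , e = ∏-∣ (Unique.allFin⁺ n) (coprime i) (divides i) in a , e

      -- Comparing the two kinds of numerators on x_u = x_v

      module _ {η h : Vector Carrier n} (η≈h : SameForm η h) where

        numerators-off-edge : ∀ u v i →
          φ u v (h i) * φ u v Q ≈ φ u v (η i) * φ u v (vandermonde i)
        numerators-off-edge u v i =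
          trans (sym (φ.*-homo u v _ _)) (trans (φ.⟦⟧-cong u v (η≈h i)) (φ.*-homo u v _ _))

        -- Substituting directly would give 0 = 0, so the regular factor x_u - x_v is removed first.
        cancel-δ : ∀ {u v} → u ≢ v → ∀ {a b c d} →
          a * (δ u v * b) ≈ c * (δ u v * d) → φ u v b * φ u v a ≈ φ u v d * φ u v c
        cancel-δ {u} {v} u≢v {a} {b} {c} {d} e = begin
          φ u v b * φ u v a    ≈⟨ φ.*-homo u v _ _ ⟨
          φ u v (b * a)        ≈⟨ φ.⟦⟧-cong u v (cancel (x-regular u≢v)
                                    (trans (swap b a) (trans e (sym (swap d c))))) ⟩
          φ u v (d * c)        ≈⟨ φ.*-homo u v _ _ ⟩
          φ u v d * φ u v c    ∎
          where
          swap : ∀ b a → δ u v * (b * a) ≈ a * (δ u v * b)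
          swap b a = trans (sym (*-assoc _ _ _)) (*-comm _ _)

        numerators-target : ∀ {u v} → Edge (u , v) →
          φ u v (deletedQ (u , v)) * φ u v (h v) ≈ φ u v (cofactor u v) * φ u v (η v)
        numerators-target {u} {v} uv@(u<v , _) = trans
          (cancel-δ (<⇒≢ u<v) (begin
            h v * (δ u v * deletedQ (u , v))   ≈⟨ *-congˡ (Q-deletedQ uv) ⟨
            h v * Q                            ≈⟨ η≈h v ⟩
            η v * vandermonde v                ≈⟨ *-congˡ (vandermonde-cofactor (<⇒≢ u<v ∘ ≡.sym)) ⟩
            η v * (δ u v * cofactor v u)       ∎))
          (*-congʳ (sym (φ-cofactor u v)))

        -- The sign arises because Q contains x_u - x_v while Δ_u contains x_v - x_u; Δ_v contains
        -- x_u - x_v, so no sign appears at the target.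
        numerators-source : ∀ {u v} → Edge (u , v) →
          φ u v (deletedQ (u , v)) * φ u v (h u) ≈ φ u v (cofactor u v) * - φ u v (η u)
        numerators-source {u} {v} uv@(u<v , _) = trans
          (cancel-δ (<⇒≢ u<v) (begin
            h u * (δ u v * deletedQ (u , v))   ≈⟨ *-congˡ (Q-deletedQ uv) ⟨
            h u * Q                            ≈⟨ η≈h u ⟩
            η u * vandermonde u                ≈⟨ *-congˡ (vandermonde-cofactor (<⇒≢ u<v)) ⟩
            η u * (δ v u * cofactor u v)       ≈⟨ *-congˡ (*-congʳ (-[x-y]≈y-x u v)) ⟨
            η u * (- δ u v * cofactor u v)     ≈⟨ *-congˡ (-‿distribˡ-* _ _) ⟨
            η u * - (δ u v * cofactor u v)     ≈⟨ -‿distribʳ-* _ _ ⟨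
            - (η u * (δ u v * cofactor u v))   ≈⟨ -‿distribˡ-* _ _ ⟩
            - η u * (δ u v * cofactor u v)     ∎))
          (*-congˡ (φ.-‿homo u v _))
          where
          -[x-y]≈y-x : ∀ a b → - δ a b ≈ δ b a
          -[x-y]≈y-x a b = trans (sym (-‿+-comm _ _))
            (trans (+-congˡ (-‿involutive _)) (+-comm _ _))

        -- On an edge the source and target identities have equal right-hand sides by η_v ≡ -η_u,
        -- and the image of `deletedQ` is regular. On a nonedge Δ_u vanishes while the image of Q is
        -- regular.
        logarithmic⇒compatible : Logarithmic η → Compatible E h
        logarithmic⇒compatible L = record { edge = edge ; nonedge = nonedge }
          where
          open Logarithmic L

          edge-< : ∀ {u v} → Edge (u , v) → φ u v (h u) ≈ φ u v (h v)
          edge-< uv = cancel (regular-φ-deletedQ uv) (trans (numerators-source uv)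
            (trans (*-congˡ (sym (on-edge uv))) (sym (numerators-target uv))))

          edge : ∀ {u v} → u ≢ v → E u v → φ u v (h u) ≈ φ u v (h v)
          edge {u} {v} u≢v uv with <-cmp u v
          ... | tri< u<v _ _ = edge-< (u<v , uv)
          ... | tri≈ _ u≡v _ = ⊥-elim (u≢v u≡v)
          ... | tri> _ _ v<u = φ-flip (sym (edge-< (v<u , E-sym uv)))

          nonedge : ∀ {u v} → u ≢ v → ¬ E u v → φ u v (h u) ≈ 0#
          nonedge {u} {v} u≢v ¬uv = regular-φ-Q ¬uv _ (trans (*-comm _ _)
            (trans (numerators-off-edge u v u)
              (trans (*-congˡ (φ-vandermonde-source u≢v)) (zeroʳ _))))

        compatible⇒logarithmic : Compatible E h → Logarithmic η
        compatible⇒logarithmic H = record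
          { off-edge = λ {u} {v} uv@(u<v , e) {i} i≢u i≢v →
              regular-φ-vandermonde i≢u i≢v _ (trans (*-comm _ _)
                (trans (sym (numerators-off-edge u v i))
                  (trans (*-congˡ (φ-Q-< uv)) (zeroʳ _))))
          ; on-edge = λ {u} {v} uv@(u<v , e) → cancel (regular-φ-cofactor u v)
              (trans (sym (numerators-target uv))
                (trans (*-congˡ (sym (Compatible.edge H (<⇒≢ u<v) e))) (numerators-source uv)))
          }

-- Spans and fractions

module _ {r ℓr m ℓm p} {R : CommutativeRing r ℓr} (M : Module R m ℓm)
  (X : Pred (Module.Carrierᴹ M) p) where
  open Module M

  span-resp : ∀ {y z} → y ≈ᴹ z → Span M X y → Span M X z
  span-resp y≈z (n , a , x , x∈X , e) = n , a , x , x∈X , ≈ᴹ-trans (≈ᴹ-sym y≈z) e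

  span-0 : Span M X 0ᴹ
  span-0 = 0 , (λ ()) , (λ ()) , (λ ()) , ≈ᴹ-refl

  span-∷ : ∀ a {x y} → X x → Span M X y → Span M X (a *ₗ x +ᴹ y)
  span-∷ a {x} x∈X (n , b , z , z∈X , e) =
    suc n , a Vector.∷ b , x Vector.∷ z ,
    (λ { zero → x∈X ; (suc i) → z∈X i }) , +ᴹ-congˡ e

  span-∈ : ∀ {x} → X x → Span M X x
  span-∈ {x} x∈X = span-resp
    (≈ᴹ-trans (+ᴹ-identityʳ _) (*ₗ-identityˡ x))
    (span-∷ (CommutativeRing.1# R) x∈X span-0)

  span-induction : ∀ {q} (N : Pred Carrierᴹ q) →
    (∀ {y z} → y ≈ᴹ z → N y → N z) → N 0ᴹ → (∀ a {x y} → X x → N y → N (a *ₗ x +ᴹ y)) →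
    ∀ {y} → Span M X y → N y
  span-induction N resp N0 N∷ (n , a , x , x∈X , e) = resp (≈ᴹ-sym e) (go n a x x∈X)
    where
    open MonoidSum +ᴹ-monoid using (sum)
    go : ∀ n (a : Vector _ n) (x : Vector Carrierᴹ n) → (∀ i → X (x i)) → N (sum (λ i → a i *ₗ x i))
    go zero    a x x∈X = N0
    go (suc n) a x x∈X = N∷ (a zero) (x∈X zero) (go n (a ∘ suc) (x ∘ suc) (x∈X ∘ suc))

  span-+ : ∀ {y z} → Span M X y → Span M X z → Span M X (y +ᴹ z)
  span-+ {z = z} y∈ z∈ = span-induction (λ y → Span M X (y +ᴹ z))
    (λ y≈y′ → span-resp (+ᴹ-congʳ y≈y′))
    (span-resp (≈ᴹ-sym (+ᴹ-identityˡ z)) z∈)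
    (λ a x∈X y+z∈ → span-resp (≈ᴹ-sym (+ᴹ-assoc _ _ _)) (span-∷ a x∈X y+z∈))
    y∈

  span-*ₗ : ∀ a {y} → Span M X y → Span M X (a *ₗ y)
  span-*ₗ a = span-induction (λ y → Span M X (a *ₗ y))
    (λ y≈y′ → span-resp (*ₗ-congˡ y≈y′))
    (span-resp (≈ᴹ-sym (*ₗ-zeroʳ a)) span-0)
    (λ b x∈X ay∈ → span-resp
      (≈ᴹ-sym (≈ᴹ-trans (*ₗ-distribˡ a _ _) (+ᴹ-congʳ (≈ᴹ-sym (*ₗ-assoc a b _)))))
      (span-∷ _ x∈X ay∈))

module _ {c ℓ} (R : CommutativeRing c ℓ) where
  open CommutativeRing R
  open Fractions R
  open SemiringIdentities R

  ι-isHomomorphism : IsHomomorphism R fractions ι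
  ι-isHomomorphism = isHomomorphism R fractions ι (λ a≈b → mk≈ᶠ (*-congʳ a≈b))
    (λ a b → mk≈ᶠ (ι-+-homo a b)) (λ a b → mk≈ᶠ (ι-*-homo a b)) (mk≈ᶠ refl)

  ι-injective : ∀ {a b} → ι a ≈ᶠ ι b → a ≈ b
  ι-injective (mk≈ᶠ e) = trans (sym (*-identityʳ _)) (trans e (*-identityʳ _))

  ι-*-/ : ∀ a q → ι (proj₁ q) *ᶠ (a / q) ≈ᶠ ι a
  ι-*-/ a (q , _) = mk≈ᶠ (trans (*-identityʳ _) (trans (*-comm q a) (*-congˡ (sym (*-identityˡ q)))))

  /-cong : ∀ {a b q} → a ≈ b → a / q ≈ᶠ b / q
  /-cong a≈b = mk≈ᶠ (*-congʳ a≈b)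

  0/ : ∀ {a} q → a ≈ 0# → a / q ≈ᶠ ι 0#
  0/ q a≈0 = mk≈ᶠ (trans (*-identityʳ _) (trans a≈0 (sym (zeroˡ _))))

  +-/ : ∀ a b q → (a + b) / q ≈ᶠ a / q +ᶠ b / q
  +-/ a b (q , _) = mk≈ᶠ (trans (sym (*-assoc _ q q)) (*-congʳ (distribʳ q a b)))

  *-/ : ∀ a b q → (a * b) / q ≈ᶠ ι a *ᶠ (b / q)
  *-/ a b (q , _) = mk≈ᶠ (*-congˡ (*-identityˡ q))

-- Graphic arrangements

module _ {c ℓ₁ ℓ₂} (𝕂 : HeytingField c ℓ₁ ℓ₂) (n : ℕ) where
  open Arrangements 𝕂 n
  private
    module K = CommutativeRing scalars
    module FK = Forms scalars n
    constant-homo = constant-isHomomorphism scalars n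
    module constant = IsRingHomomorphism constant-homo
  open NonZeroDivisors S
  open Fractions S
  open Multivariate scalars using (regular-difference)
  open CommutativeRing S hiding (zero)
  open RingProperties ring

  -- Substitutions in the polynomial ring

  substituted : Fin n → Fin n → Vector Carrier n
  substituted u v w = if does (w ≟ u) then x[ v ] else x[ w ]

  substitute : Fin n → Fin n → Carrier → Carrier
  substitute u v = evaluateAt {R = scalars} {T = S} constant-homo (substituted u v)

  substitute-homo : ∀ u v → IsHomomorphism S S (substitute u v)
  substitute-homo u v = evaluateAt-isHomomorphism constant-homo (substituted u v)

  substitute-source : ∀ u v → substitute u v x[ u ] ≈ x[ v ]
  substitute-source u v = trans (evaluateAt-x constant-homo (substituted u v) u)
    (reflexive (if-true (u ≟ u) ≡.refl))

  substitute-other : ∀ {u v w} → w ≢ u → substitute u v x[ w ] ≈ x[ w ]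
  substitute-other {u} {v} {w} w≢u = trans (evaluateAt-x constant-homo (substituted u v) w)
    (reflexive (if-false (w ≟ u) w≢u))

  -- The identity and the substitution agree on constants and on all variables but x_u, where they
  -- differ by exactly x_u - x_v.
  substitute-modulo : ∀ u v a → ∃[ k ] a ≈ substitute u v a + (x[ u ] - x[ v ]) * k
  substitute-modulo u v = homomorphisms-congruent {R = scalars} {T = S} d n
    (Identity.isRingHomomorphism _ refl) (substitute-homo u v)
    (λ a → ≈⇒≡ᵈ {R = scalars} {T = S} d (sym (evaluateAt-constant constant-homo (substituted u v) a)))
    at-x
    where
    d = x[ u ] - x[ v ]
    at-x : ∀ w → ∃[ k ] x[ w ] ≈ substitute u v x[ w ] + d * k
    at-x w with w ≟ u
    ... | no w≢u     = ≈⇒≡ᵈ {R = scalars} {T = S} d (sym (substitute-other w≢u))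
    ... | yes ≡.refl = 1# , sym (trans (+-cong (substitute-source u v) (*-identityʳ d))
      (trans (sym (+-assoc _ _ _)) (xyx⁻¹≈y _ _)))

  open Products S using (∏-filter; ∏-cong; ∏-*; _∣_; _,_)
  open Substitutions S n x[_] regular-difference substitute substitute-homo
    substitute-source substitute-other substitute-modulo

  constant-basis : ∀ u i → constant n (FK.basis u i) ≈ ΩV.basis u i
  constant-basis u i with does (u ≟ i)
  ... | true  = constant.1#-homo
  ... | false = constant.0#-homo

  -- Linear forms of the diagonals

  diagonalForm : Fin n → Fin n → Vector K.Carrier n
  diagonalForm u v i = FK.basis u i K.- FK.basis v i

  d-diagonal : Fin n → Fin n → Vector Carrier n
  d-diagonal u v i = constant n (diagonalForm u v i)

  d-diagonal-basis : ∀ u v i → d-diagonal u v i ≈ ΩV.basis u i - ΩV.basis v i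
  d-diagonal-basis u v i = trans (constant.+-homo _ _)
    (+-cong (constant-basis u i) (trans (constant.-‿homo _) (-‿cong (constant-basis v i))))

  linear-diagonal : ∀ u v → linear (diagonalForm u v) ≈ δ u v
  linear-diagonal u v = begin
    sum (λ i → d-diagonal u v i * x[ i ])
      ≈⟨ sum-cong-≋ (λ i → trans (*-congʳ (d-diagonal-basis u v i)) (expand _ _ _)) ⟩
    sum (λ i → x[ i ] * ΩV.basis u i + - x[ i ] * ΩV.basis v i)
      ≈⟨ ∑-distrib-+ (λ i → x[ i ] * ΩV.basis u i) (λ i → - x[ i ] * ΩV.basis v i) ⟩
    sum (λ i → x[ i ] * ΩV.basis u i) + sum (λ i → - x[ i ] * ΩV.basis v i)
      ≈⟨ +-cong (sum-basis S n x[_] u) (sum-basis S n (λ i → - x[ i ]) v) ⟩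
    δ u v ∎
    where
    open CommutativeMonoidSum +-commutativeMonoid using (sum; sum-cong-≋; ∑-distrib-+)
    open SetoidReasoning setoid
    expand : ∀ a b y → (a - b) * y ≈ y * a + - y * b
    expand a b y = trans (*-comm _ _) (trans (distribˡ y a (- b))
      (+-congˡ (trans (sym (-‿distribʳ-* y b)) (-‿distribˡ-* y b))))

  d-diagonal-source : ∀ {u v} → u ≢ v → d-diagonal u v u ≈ 1#
  d-diagonal-source {u} {v} u≢v = trans (d-diagonal-basis u v u) (trans
    (+-cong (reflexive (if-true (u ≟ u) ≡.refl))
            (trans (-‿cong (reflexive (if-false (v ≟ u) (u≢v ∘ ≡.sym)))) -0#≈0#))
    (+-identityʳ _))

  d-diagonal-target : ∀ {u v} → u ≢ v → d-diagonal u v v ≈ - 1#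
  d-diagonal-target {u} {v} u≢v = trans (d-diagonal-basis u v v) (trans
    (+-cong (reflexive (if-false (u ≟ v) u≢v)) (-‿cong (reflexive (if-true (v ≟ v) ≡.refl))))
    (+-identityˡ _))

  d-diagonal-other : ∀ {u v i} → i ≢ u → i ≢ v → d-diagonal u v i ≈ 0#
  d-diagonal-other {u} {v} {i} i≢u i≢v = trans (d-diagonal-basis u v i) (trans
    (+-cong (reflexive (if-false (u ≟ i) (i≢u ∘ ≡.sym)))
            (trans (-‿cong (reflexive (if-false (v ≟ i) (i≢v ∘ ≡.sym)))) -0#≈0#))
    (+-identityˡ _))

  -- Logarithmic forms of the graphic arrangement

  module _ (G : SimpleGraph n) where
    open SimpleGraph G
    open GraphicForms _~?_ ~-sym using (Logarithmic; SameForm; vandermonde; vandermonde-regular;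
      vandermondeFactor; logarithmic⇒numerators; compatible⇒numerators;
      logarithmic⇒compatible; compatible⇒logarithmic)
      renaming (Q to edgeProduct)
    private
      𝒜 = graphicArrangement G
      q = Q 𝒜
      module φ u v = IsRingHomomorphism (substitute-homo u v)
      module F = CommutativeRing fractions
      module ι = IsRingHomomorphism (ι-isHomomorphism S)

    Q≈edgeProduct : proj₁ q ≈ edgeProduct
    Q≈edgeProduct = trans (reduced edges-sound)
      (∏-filter (λ (u , v) → (u <? v) ×-dec (u ~? v)) _ (cartesianProduct (allFin n) (allFin n)))
      where
      reduced : ∀ {es} (ps : All IsEdge es) →
        ∏ (map α[_] (All.reduce (edgeHyperplane G) ps)) ≈ ∏ (map (λ (u , v) → δ u v) es)
      reduced []       = refl
      reduced (p ∷ ps) = *-cong (linear-diagonal _ _) (reduced ps)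

    LogarithmicAlong : ΩF.Form₁ → Fin n × Fin n → Set (c ⊔ ℓ₁)
    LogarithmicAlong ω (u , v) = ∃[ θ ]
      (ι (proj₁ q) ΩF.•₁ ω) ΩF.∧ (ι ∘ d-diagonal u v) ΩF.≈₂ ι₂ (linear (diagonalForm u v) ΩV.•₂ θ)

    module _ {ω : ΩF.Form₁} {η : Vector Carrier n} (ω≈η : ω ΩF.≈₁ η ÷ q) where

      wedge : ∀ (c : Vector Carrier n) i j →
        (ι (proj₁ q) *ᶠ ω i) *ᶠ ι (c j) F.- (ι (proj₁ q) *ᶠ ω j) *ᶠ ι (c i) ≈ᶠ
        ι (η i * c j - η j * c i)
      wedge c i j = begin
        (ι (proj₁ q) *ᶠ ω i) *ᶠ ι (c j) F.- (ι (proj₁ q) *ᶠ ω j) *ᶠ ι (c i)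
          ≈⟨ F.+-cong {x = (ι (proj₁ q) *ᶠ ω i) *ᶠ ι (c j)} (product i j) (F.-‿cong (product j i)) ⟩
        ι (η i * c j) F.- ι (η j * c i)
          ≈⟨ F.+-congˡ {ι (η i * c j)} (ι.-‿homo (η j * c i)) ⟨
        ι (η i * c j) F.+ ι (- (η j * c i))
          ≈⟨ ι.+-homo _ _ ⟨
        ι (η i * c j - η j * c i) ∎
        where
        open SetoidReasoning F.setoid
        product : ∀ i j → (ι (proj₁ q) *ᶠ ω i) *ᶠ ι (c j) ≈ᶠ ι (η i * c j)
        product i j = F.trans
          (F.*-congʳ {ι (c j)} (F.trans (F.*-congˡ {ι (proj₁ q)} (ω≈η i)) (ι-*-/ S (η i) q)))
          (F.sym (ι.*-homo (η i) (c j)))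

      -- Along x_u = x_v a logarithmic η is a multiple of dx_u − dx_v.
      logarithmicAlong⇒ : ∀ {u v} → u < v → LogarithmicAlong ω (u , v) → ∀ i →
        substitute u v (η i) ≈ substitute u v (η u) * substitute u v (d-diagonal u v i)
      logarithmicAlong⇒ {u} {v} u<v (θ , e) i = trans
        (trans (sym (*-identityʳ _)) (*-congˡ (sym (trans
          (φ.⟦⟧-cong u v (d-diagonal-source (<⇒≢ u<v))) (φ.1#-homo u v)))))
        (symmetric i u)
        where
        d = d-diagonal u v

        vanishes : ∀ i j → i < j → substitute u v (η i * d j - η j * d i) ≈ 0#
        vanishes i j i<j = φ-∣ (φ-δ u v) (θ i j i<j , trans (*-comm _ _) (trans
          (*-congʳ (sym (linear-diagonal u v)))
          (ι-injective S (F.trans (F.sym (e i j i<j)) (wedge d i j)))))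

        ordered : ∀ i j → i < j →
          substitute u v (η i) * substitute u v (d j) ≈ substitute u v (η j) * substitute u v (d i)
        ordered i j i<j = trans (sym (φ.*-homo u v _ _)) (trans
          (x∙y⁻¹≈ε⇒x≈y _ _ (trans (sym (φ-minus u v _ _)) (vanishes i j i<j)))
          (φ.*-homo u v _ _))

        -- Components of a 2-form exist for i < j only, while the case j = u, where d_u = 1, is
        -- wanted for every i.
        symmetric : ∀ i j →
          substitute u v (η i) * substitute u v (d j) ≈ substitute u v (η j) * substitute u v (d i)
        symmetric i j with <-cmp i j
        ... | tri< i<j _ _    = ordered i j i<j
        ... | tri≈ _ ≡.refl _ = refl
        ... | tri> _ _ j<i    = sym (ordered j i j<i)

      -- On x_u = x_v both η_i d_j and η_j d_i become η_u d_i d_j; the quotients of their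
      -- differences by x_u - x_v are the components of θ.
      ⇒logarithmicAlong : ∀ {u v} →
        (∀ i → substitute u v (η i) ≈ substitute u v (η u) * substitute u v (d-diagonal u v i)) →
        LogarithmicAlong ω (u , v)
      ⇒logarithmicAlong {u} {v} proportional = (λ i j _ → proj₁ (quotient i j)) , λ i j _ →
        F.trans (wedge d i j) (ι.⟦⟧-cong (trans (sym (proj₂ (quotient i j)))
          (trans (*-comm _ _) (*-congʳ (sym (linear-diagonal u v))))))
        where
        d = d-diagonal u v
        open import Algebra.Properties.CommutativeSemigroup *-commutativeSemigroup using (xy∙z≈xz∙y)

        vanishes : ∀ i j → substitute u v (η i * d j - η j * d i) ≈ 0#
        vanishes i j = trans (φ-minus u v _ _) (x-x≈0 (trans (φ.*-homo u v _ _)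
          (trans (*-congʳ (proportional i)) (trans (xy∙z≈xz∙y _ _ _)
            (trans (*-congʳ (sym (proportional j))) (sym (φ.*-homo u v _ _)))))))

        quotient : ∀ i j → ∃[ k ] k * δ u v ≈ η i * d j - η j * d i
        quotient i j = let k , e = φ≈0⇒δ∣ (vanishes i j) in k , e

    along-edges⇒ : ∀ ω {es} (ps : All IsEdge es) →
      All (λ H → ∃[ θ ] (ι (proj₁ q) ΩF.•₁ ω) ΩF.∧ (ι ∘ dα[ H ]) ΩF.≈₂ ι₂ (α[ H ] ΩV.•₂ θ))
        (All.reduce (edgeHyperplane G) ps) →
      ∀ {e} → e ∈ˡ es → LogarithmicAlong ω e
    along-edges⇒ ω (_ ∷ _)  (l ∷ _)  (here ≡.refl) = l
    along-edges⇒ ω (_ ∷ ps) (_ ∷ ls) (there e∈)    = along-edges⇒ ω ps ls e∈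

    ⇒along-edges : ∀ ω {es} (ps : All IsEdge es) → (∀ {e} → IsEdge e → LogarithmicAlong ω e) →
      All (λ H → ∃[ θ ] (ι (proj₁ q) ΩF.•₁ ω) ΩF.∧ (ι ∘ dα[ H ]) ΩF.≈₂ ι₂ (α[ H ] ΩV.•₂ θ))
        (All.reduce (edgeHyperplane G) ps)
    ⇒along-edges ω []       l = []
    ⇒along-edges ω (p ∷ ps) l = l p ∷ ⇒along-edges ω ps l

    overVandermonde : Vector Carrier n → ΩF.Form₁
    overVandermonde h i = h i / (vandermonde i , vandermonde-regular i)

    -- The description of Ω¹ through which both inclusions pass.
    HasCompatibleNumerators : Pred ΩF.Form₁ (c ⊔ ℓ₁)
    HasCompatibleNumerators ω = ∃[ h ] Compatible _~_ h × ω ΩF.≈₁ overVandermonde h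

    Ω¹⇒compatible : ∀ {ω} → Ω¹ 𝒜 ω → HasCompatibleNumerators ω
    Ω¹⇒compatible {ω} ((η , ω≈η) , along) = h , logarithmic⇒compatible same L ,
      λ i → F.trans (ω≈η i) (mk≈ᶠ (trans (sym (same i)) (*-congˡ (sym Q≈edgeProduct))))
      where
      on : ∀ {u v} → IsEdge (u , v) → ∀ i →
        substitute u v (η i) ≈ substitute u v (η u) * substitute u v (d-diagonal u v i)
      on {u} {v} uv = logarithmicAlong⇒ ω≈η (proj₁ uv) (along-edges⇒ ω edges-sound along
        (∈-filter⁺ _ (∈-cartesianProduct⁺ (∈-allFin u) (∈-allFin v)) uv))

      L : Logarithmic η
      L = record
        { off-edge = λ {u} {v} uv {i} i≢u i≢v → trans (on uv i) (trans
            (*-congˡ (trans (φ.⟦⟧-cong u v (d-diagonal-other i≢u i≢v)) (φ.0#-homo u v))) (zeroʳ _))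
        ; on-edge = λ {u} {v} uv → trans (on uv v) (trans
            (*-congˡ (trans (φ.⟦⟧-cong u v (d-diagonal-target (<⇒≢ (proj₁ uv))))
              (trans (φ.-‿homo u v _) (-‿cong (φ.1#-homo u v)))))
            (trans (sym (-‿distribʳ-* _ _)) (-‿cong (*-identityʳ _))))
        }

      h = proj₁ (logarithmic⇒numerators L)
      same = proj₂ (logarithmic⇒numerators L)

    compatible⇒Ω¹ : ∀ {ω} → HasCompatibleNumerators ω → Ω¹ 𝒜 ω
    compatible⇒Ω¹ {ω} (h , H , ω≈h) =
      (η , ω≈η) , ⇒along-edges ω edges-sound (λ uv → ⇒logarithmicAlong ω≈η (proportional uv))
      where
      η = proj₁ (compatible⇒numerators H)
      same = proj₂ (compatible⇒numerators H)

      ω≈η : ω ΩF.≈₁ η ÷ q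
      ω≈η i = F.trans (ω≈h i) (mk≈ᶠ (trans (*-congˡ Q≈edgeProduct) (same i)))

      open Logarithmic (compatible⇒logarithmic same H)

      proportional : ∀ {u v} → IsEdge (u , v) → ∀ i →
        substitute u v (η i) ≈ substitute u v (η u) * substitute u v (d-diagonal u v i)
      proportional {u} {v} uv@(u<v , _) i = at (i ≟ u) (i ≟ v)
        where
        at : Dec (i ≡ u) → Dec (i ≡ v) →
          substitute u v (η i) ≈ substitute u v (η u) * substitute u v (d-diagonal u v i)
        at (yes ≡.refl) _ = sym (trans (*-congˡ (trans
          (φ.⟦⟧-cong u v (d-diagonal-source (<⇒≢ u<v))) (φ.1#-homo u v))) (*-identityʳ _))
        at (no _) (yes ≡.refl) = trans (on-edge uv) (sym (trans
          (*-congˡ (trans (φ.⟦⟧-cong u v (d-diagonal-target (<⇒≢ u<v)))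
            (trans (φ.-‿homo u v _) (-‿cong (φ.1#-homo u v)))))
          (trans (sym (-‿distribʳ-* _ _)) (-‿cong (*-identityʳ _)))))
        at (no i≢u) (no i≢v) = trans (off-edge uv i≢u i≢v) (sym (trans
          (*-congˡ (trans (φ.⟦⟧-cong u v (d-diagonal-other i≢u i≢v)) (φ.0#-homo u v))) (zeroʳ _)))

    open Module RationalForms using (_+ᴹ_; 0ᴹ; _*ₗ_)

    -- Clique forms over the common denominators

    module _ (F : Subset n) where

      summand : Fin n → ΩF.Form₁
      summand u = ΩV.basis u ÷ γ-denominator F u

      summand-off : ∀ {u i} → u ≢ i → summand u i ≈ᶠ ι 0#
      summand-off {u} {i} u≢i = 0/ S (γ-denominator F u) (reflexive (if-false (u ≟ i) u≢i))

      sum-∉ : ∀ {i L} → All (i ≢_) L → foldr _+ᴹ_ 0ᴹ (map summand L) i ≈ᶠ ι 0#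
      sum-∉ []          = F.refl
      sum-∉ {i} {u ∷ L} (i≢u ∷ i∉L) =
        F.trans (F.+-cong {summand u i} (summand-off (i≢u ∘ ≡.sym)) (sum-∉ i∉L)) (F.+-identityˡ _)

      sum-∈ : ∀ {i L} → Unique L → i ∈ˡ L → foldr _+ᴹ_ 0ᴹ (map summand L) i ≈ᶠ summand i i
      sum-∈ {i} (i∉L ∷ _) (here ≡.refl) =
        F.trans (F.+-congˡ {summand i i} (sum-∉ i∉L)) (F.+-identityʳ _)
      sum-∈ {i} {u ∷ L} (u∉L ∷ L!) (there i∈L) =
        F.trans (F.+-cong {summand u i} (summand-off (All.lookup u∉L i∈L)) (sum-∈ L! i∈L))
          (F.+-identityˡ _)

      otherFactor : Fin n → Fin n → Carrier
      otherFactor i j = if does ((j ∈? F) ×-dec ¬? (j ≟ i)) then δ j i else 1#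

      -- The indices j ≠ i are sorted by membership in F. As i lies in F, the index j = i
      -- contributes 1 to each product.
      vandermonde-split : ∀ {i} → i ∈ F →
        vandermonde i ≈ complementProduct F i * proj₁ (γ-denominator F i)
      vandermonde-split {i} i∈F = begin
        vandermonde i
          ≈⟨ ∏-cong (allFin n) split ⟩
        ∏ (map (λ j → complementFactor F i j * otherFactor i j) (allFin n))
          ≈⟨ ∏-* (complementFactor F i) (otherFactor i) (allFin n) ⟩
        complementProduct F i * ∏ (map (otherFactor i) (allFin n))
          ≈⟨ *-congˡ (∏-filter (λ j → (j ∈? F) ×-dec ¬? (j ≟ i)) (λ j → δ j i) (allFin n)) ⟨
        complementProduct F i * proj₁ (γ-denominator F i) ∎
        where
        open SetoidReasoning setoid
        split : ∀ j → vandermondeFactor i j ≈ complementFactor F i j * otherFactor i j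
        split j = if-elim (λ a → vandermondeFactor i j ≈ a * otherFactor i j) (j ∈? F)
          (λ j∈F → if-elim (λ a → vandermondeFactor i j ≈ 1# * a) ((j ∈? F) ×-dec ¬? (j ≟ i))
            (λ (_ , j≢i) → trans (reflexive (if-false (j ≟ i) j≢i)) (sym (*-identityˡ _)))
            (λ ¬j → trans
              (reflexive (if-true (j ≟ i)
                (decidable-stable (j ≟ i) (λ j≢i → ¬j (j∈F , j≢i)))))
              (sym (*-identityˡ _))))
          (λ j∉F → trans (reflexive (if-false (j ≟ i) λ { ≡.refl → j∉F i∈F }))
            (trans (sym (*-identityʳ _))
              (*-congˡ (reflexive (≡.sym (if-false ((j ∈? F) ×-dec ¬? (j ≟ i)) (j∉F ∘ proj₁)))))))

      γ≈complementProduct : γ F ΩF.≈₁ overVandermonde (complementProduct F)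
      γ≈complementProduct i = at (i ∈? F)
        where
        at : Dec (i ∈ F) → γ F i ≈ᶠ overVandermonde (complementProduct F) i
        at (no i∉F)  = F.trans (sum-∉ (All.map (λ u∈F i≡u → i∉F (≡.subst (_∈ F) (≡.sym i≡u) u∈F))
                         (All.all-filter (_∈? F) (allFin n))))
                       (F.sym (0/ S _ (complementProduct-∉ F i∉F)))
        at (yes i∈F) = F.trans
          (sum-∈ (Unique.filter⁺ (_∈? F) (Unique.allFin⁺ n)) (∈-filter⁺ (_∈? F) (∈-allFin i) i∈F))
          (mk≈ᶠ (trans (*-congʳ (reflexive (if-true (i ≟ i) ≡.refl)))
            (trans (*-identityˡ _) (vandermonde-split i∈F))))

    IsCliqueForm : Pred ΩF.Form₁ ℓ₁
    IsCliqueForm ω = ∃[ F ] Nonempty F × IsClique F × ω ΩF.≈₁ γ F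

    overVandermonde-+ : ∀ h k i → overVandermonde (λ i → h i + k i) i ≈ᶠ
      overVandermonde h i +ᶠ overVandermonde k i
    overVandermonde-+ h k i = +-/ S (h i) (k i) _

    overVandermonde-* : ∀ a h i → overVandermonde (λ i → a * h i) i ≈ᶠ ι a *ᶠ overVandermonde h i
    overVandermonde-* a h i = *-/ S a (h i) _

    cliqueForms-span⊆ : ∀ {ω} → Span RationalForms IsCliqueForm ω → HasCompatibleNumerators ω
    cliqueForms-span⊆ = span-induction RationalForms IsCliqueForm HasCompatibleNumerators
      (λ y≈z (h , H , y≈h) → h , H , λ i → F.trans (F.sym (y≈z i)) (y≈h i))
      (_ , C.0-closed , λ i → F.sym (0/ S _ refl))
      (λ a {x} {y} (F , _ , clique , x≈γ) (h , H , y≈h) → _ ,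
        C.+-closed (C.•-closed a (complementProduct-compatible _~_ F clique)) H , λ i →
        F.trans
          (F.+-cong {ι a *ᶠ x i} {_} {y i}
            (F.trans (F.*-congˡ {ι a} (F.trans (x≈γ i) (γ≈complementProduct F i)))
              (F.sym (overVandermonde-* a (complementProduct F) i)))
            (y≈h i))
          (F.sym (overVandermonde-+ (λ i → a * complementProduct F i) h i)))
      where module C = IsSubmodule (compatible-isSubmodule _~_)

    -- The vectors h with h / Δ in the span form a submodule containing every clique vector. At the
    -- start all vertices are still to be cleared, so the condition on the cleared ones is vacuous.
    ⊆cliqueForms-span : ∀ {ω} → HasCompatibleNumerators ω → Span RationalForms IsCliqueForm ω
    ⊆cliqueForms-span {ω} (h , H , ω≈h) = resp (λ i → F.sym (ω≈h i))
      (compatible∈span (allFin n) _~?_ ~-sym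
        {M = λ h → Span RationalForms IsCliqueForm (overVandermonde h)}
        (record
          { resp     = λ h≈k → resp (λ i → /-cong S (h≈k i))
          ; 0-closed = resp (λ i → F.sym (0/ S _ refl)) (span-0 RationalForms IsCliqueForm)
          ; +-closed = λ {h} {k} H K → resp (λ i → F.sym (overVandermonde-+ h k i))
                         (span-+ RationalForms IsCliqueForm H K)
          ; •-closed = λ a {h} H → resp (λ i → F.sym (overVandermonde-* a h i))
                         (span-*ₗ RationalForms IsCliqueForm a H) })
        (λ F F≢∅ clique → span-∈ RationalForms IsCliqueForm
          (F , F≢∅ , clique , λ i → F.sym (γ≈complementProduct F i)))
        H (λ i i∉ → ⊥-elim (i∉ (∈-allFin i))))
      where
      resp : ∀ {ω ω′} → ω ΩF.≈₁ ω′ →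
        Span RationalForms IsCliqueForm ω → Span RationalForms IsCliqueForm ω′
      resp = span-resp RationalForms IsCliqueForm

theorem1p4 : ∀ {c ℓ₁ ℓ₂} (𝕂 : HeytingField c ℓ₁ ℓ₂) (ℓ : ℕ) (G : SimpleGraph ℓ) →
    let open Arrangements 𝕂 ℓ in
    Generates RationalForms
    (λ ω → ∃[ F ] Nonempty F × SimpleGraph.IsClique G F × ω ΩF.≈₁ γ F)
    (Ω¹ (graphicArrangement G))
theorem1p4 𝕂 ℓ G =
  (λ ω∈span → compatible⇒Ω¹ 𝕂 ℓ G (cliqueForms-span⊆ 𝕂 ℓ G ω∈span)) ,
  (λ ω∈Ω¹ → ⊆cliqueForms-span 𝕂 ℓ G (Ω¹⇒compatible 𝕂 ℓ G ω∈Ω¹))
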